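{- Let $\varphi_{\mathrm{Sk}}$ be a first-order sentence without equality in which (a) no function symbol of arity larger than one occurs, (b) no existential quantifiers occur, and (c) every atom contains at most one variable (possibly with multiple occurrences). Then one can effectively construct a sentence $\varphi'_{\mathrm{Sk}}$, equisatisfiable with $\varphi_{\mathrm{Sk}}$, in which all occurring predicate symbols are unary and no constant symbols or function symbols appear other than those occurring in $\varphi_{\mathrm{Sk}}$. Moreover, the length of $\varphi'_{\mathrm{Sk}}$ lies in $\mathcal{O}(\mathrm{len}(\varphi_{\mathrm{Sk}})^4)$.
   Context: $\mathrm{len}(\chi)$ denotes the length (number of symbols) of a formula $\chi$. Two sentences are equisatisfiable if one has a model iff the other has one. -}

module Defs where

open import Data.Nat using (ℕ; zero; suc; _+_; _*_; _^_; _≤_)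
open import Data.Nat.Properties using (_≟_)
open import Data.Bool using (Bool; true; false)
open import Data.List using (List; []; _∷_; _++_)
open import Data.List.Membership.Propositional using (_∈_)
open import Data.List.Relation.Unary.All using (All)
open import Data.Vec using (Vec; []; _∷_)
open import Data.Product using (Σ; _×_; _,_; ∃)
open import Data.Sum using (_⊎_)
open import Data.Empty using (⊥)
open import Data.Unit using (⊤)
open import Relation.Nullary using (¬_; yes; no)
open import Relation.Binary.PropositionalEquality using (_≡_)
open import Function.Bundles using (_⇔_)

-- Variables, function symbols and predicate symbols are named by ℕ;
-- a symbol is identified by its (name, arity) pair.
-- Constant symbols are function symbols of arity 0.
-- Formulas are in negation normal form (literals, ∧, ∨, ∀, ∃).

data Term : Set where
  var : ℕ → Term
  app : (f : ℕ) (k : ℕ) → Vec Term k → Term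

data Formula : Set where
  lit  : (positive : Bool) (P : ℕ) (k : ℕ) → Vec Term k → Formula
  _∧'_ : Formula → Formula → Formula
  _∨'_ : Formula → Formula → Formula
  all' : ℕ → Formula → Formula
  ex'  : ℕ → Formula → Formula

-- Length (number of symbols; parentheses/commas not counted).

mutual
  lenT : Term → ℕ
  lenT (var x) = 1
  lenT (app f k ts) = suc (lenTs ts)

  lenTs : ∀ {k} → Vec Term k → ℕ
  lenTs [] = 0
  lenTs (t ∷ ts) = lenT t + lenTs ts

len : Formula → ℕ
len (lit true P k ts) = suc (lenTs ts)
len (lit false P k ts) = suc (suc (lenTs ts))
len (φ ∧' ψ) = suc (len φ + len ψ)
len (φ ∨' ψ) = suc (len φ + len ψ)
len (all' x φ) = suc (suc (len φ))
len (ex' x φ) = suc (suc (len φ))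

mutual
  varsT : Term → List ℕ
  varsT (var x) = x ∷ []
  varsT (app f k ts) = varsTs ts

  varsTs : ∀ {k} → Vec Term k → List ℕ
  varsTs [] = []
  varsTs (t ∷ ts) = varsT t ++ varsTs ts

ClosedUnder : List ℕ → Formula → Set
ClosedUnder bs (lit s P k ts) = All (_∈ bs) (varsTs ts)
ClosedUnder bs (φ ∧' ψ) = ClosedUnder bs φ × ClosedUnder bs ψ
ClosedUnder bs (φ ∨' ψ) = ClosedUnder bs φ × ClosedUnder bs ψ
ClosedUnder bs (all' x φ) = ClosedUnder (x ∷ bs) φ
ClosedUnder bs (ex' x φ) = ClosedUnder (x ∷ bs) φ

Sentence : Formula → Set
Sentence φ = ClosedUnder [] φ

mutual
  FunOccT : ℕ → ℕ → Term → Set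
  FunOccT f k (var x) = ⊥
  FunOccT f k (app g j ts) = ((g ≡ f) × (j ≡ k)) ⊎ FunOccTs f k ts

  FunOccTs : ℕ → ℕ → ∀ {j} → Vec Term j → Set
  FunOccTs f k [] = ⊥
  FunOccTs f k (t ∷ ts) = FunOccT f k t ⊎ FunOccTs f k ts

FunOcc : ℕ → ℕ → Formula → Set
FunOcc f k (lit s P j ts) = FunOccTs f k ts
FunOcc f k (φ ∧' ψ) = FunOcc f k φ ⊎ FunOcc f k ψ
FunOcc f k (φ ∨' ψ) = FunOcc f k φ ⊎ FunOcc f k ψ
FunOcc f k (all' x φ) = FunOcc f k φ
FunOcc f k (ex' x φ) = FunOcc f k φ

FunArityAtMostOne : Formula → Set
FunArityAtMostOne φ = ∀ f k → FunOcc f k φ → k ≤ 1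

NoExists : Formula → Set
NoExists (lit s P k ts) = ⊤
NoExists (φ ∧' ψ) = NoExists φ × NoExists ψ
NoExists (φ ∨' ψ) = NoExists φ × NoExists ψ
NoExists (all' x φ) = NoExists φ
NoExists (ex' x φ) = ⊥

AllAtoms : (∀ (P k : ℕ) → Vec Term k → Set) → Formula → Set
AllAtoms Q (lit s P k ts) = Q P k ts
AllAtoms Q (φ ∧' ψ) = AllAtoms Q φ × AllAtoms Q ψ
AllAtoms Q (φ ∨' ψ) = AllAtoms Q φ × AllAtoms Q ψ
AllAtoms Q (all' x φ) = AllAtoms Q φ
AllAtoms Q (ex' x φ) = AllAtoms Q φ

AtMostOneVar : Formula → Set
AtMostOneVar = AllAtoms (λ P k ts → Σ ℕ λ x → All (_≡ x) (varsTs ts))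

InFragment : Formula → Set
InFragment φ = FunArityAtMostOne φ × NoExists φ × AtMostOneVar φ

AllPredsUnary : Formula → Set
AllPredsUnary = AllAtoms (λ P k ts → k ≡ 1)

-- Tarski semantics (structures have nonempty domains).

record Structure : Set₁ where
  field
    D    : Set
    elem : D
    fun  : ℕ → (k : ℕ) → Vec D k → D
    pred : ℕ → (k : ℕ) → Vec D k → Set

module _ (M : Structure) where
  open Structure M

  update : (ℕ → D) → ℕ → D → ℕ → D
  update ρ x d y with y ≟ x
  ... | yes _ = d
  ... | no  _ = ρ y

  mutual
    evalT : (ℕ → D) → Term → D
    evalT ρ (var x) = ρ x
    evalT ρ (app f k ts) = fun f k (evalTs ρ ts)

    evalTs : (ℕ → D) → ∀ {k} → Vec Term k → Vec D k
    evalTs ρ [] = []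
    evalTs ρ (t ∷ ts) = evalT ρ t ∷ evalTs ρ ts

  Holds : (ℕ → D) → Formula → Set
  Holds ρ (lit true P k ts) = pred P k (evalTs ρ ts)
  Holds ρ (lit false P k ts) = ¬ pred P k (evalTs ρ ts)
  Holds ρ (φ ∧' ψ) = Holds ρ φ × Holds ρ ψ
  Holds ρ (φ ∨' ψ) = Holds ρ φ ⊎ Holds ρ ψ
  Holds ρ (all' x φ) = (d : D) → Holds (update ρ x d) φ
  Holds ρ (ex' x φ) = Σ D λ d → Holds (update ρ x d) φ

Satisfiable : Formula → Set₁
Satisfiable φ = Σ Structure λ M → Holds M (λ _ → Structure.elem M) φ

Equisatisfiable : Formula → Formula → Set₁
Equisatisfiable φ ψ = Satisfiable φ ⇔ Satisfiable ψ

-- With unary function symbols only, the elements named by terms are a constant (or a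
-- default element ⋆) followed by a word of unary symbols, and since φ is universal any model
-- of φ restricts to these elements. An atom with the single variable x has arguments
-- x·w₁, …, x·wₖ and ground terms; factoring out the longest common prefix u of the wᵢ turns
-- it into Q(x·u), where the fresh unary Q stands for the atom's reduced pattern. Two
-- distinct reduced patterns can have a common instance only at finitely many constant-headed
-- special elements, which are computable from pairs of patterns (at most len φ² of them).
-- The translation marks each special element with its own unary predicate and, at a special
-- element, evaluates the atom through the first pattern it instantiates, so that the fresh
-- predicates are read consistently. Every literal becomes a conjunction over the special
-- elements of size O(len φ³), hence the O(len φ⁴) bound.

module Submission where

open import Defs
open import Data.Bool using (Bool; true; false)
open import Data.Empty using (⊥; ⊥-elim)
open import Data.List using (List; []; _∷_; _++_; [_]; length; take; drop; map; filter; concatMap; fromMaybe)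
open import Data.List.Membership.Propositional using (_∈_; _∉_; lose)
open import Data.List.Membership.Propositional.Properties using (∈-++⁺ˡ; ∈-++⁺ʳ; ∈-filter⁺; ∈-concatMap⁺)
import Data.List.Membership.DecPropositional as DecMembership
open import Data.List.Properties using (++-assoc; ++-identityʳ; ++-cancelˡ; length-++; ∷-injective; ∷-injectiveˡ)
import Data.List.Properties as List
open import Data.List.Relation.Unary.All using (All; []; _∷_; all?)
import Data.List.Relation.Unary.All as All
import Data.List.Relation.Unary.All.Properties as AllP
open import Data.List.Relation.Unary.Any using (Any; here; there)
open import Data.Maybe using (Maybe; just; nothing)
import Data.Maybe as Maybe
open import Data.Maybe.Properties using (just-injective)
open import Data.Nat using (ℕ; zero; suc; _+_; _*_; _^_; _≤_; _∸_; z≤n; s≤s; s≤s⁻¹)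
open import Data.Nat.ListAction using (sum)
open import Data.Nat.ListAction.Properties using (sum-++)
open import Data.Nat.Properties
  using (_≟_; m+n∸n≡m; +-suc; +-comm; +-assoc; +-identityʳ; *-identityʳ; *-identityˡ; *-suc; *-distribˡ-+; *-distribʳ-+;
         n≤1+n; ≤-refl; ≤-trans; ≤-reflexive; m≤m+n; m≤n+m; m∸n≤m; m⊓n≤n; m≤n⇒m≤1+n; m≤n*m; +-mono-≤; *-mono-≤;
         module ≤-Reasoning)
open import Data.Nat.Tactic.RingSolver using (solve-∀)
open import Data.Product using (Σ; _×_; _,_; proj₁; proj₂; map₁)
import Data.Product.Properties as Product
open import Data.Sum using (_⊎_; inj₁; inj₂)
import Data.Sum as Sum
open import Data.Unit using (⊤; tt)
open import Data.Vec using (Vec; []; _∷_; toList)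
import Data.Vec as Vec
import Data.Vec.Properties as VecP
import Data.Vec.Relation.Unary.All as VecAll
open VecAll using ([]; _∷_)
open import Function using (case_of_; _∘_)
open import Function.Bundles using (_⇔_; mk⇔; Equivalence)
open import Relation.Binary.Definitions using (DecidableEquality)
open import Relation.Binary.PropositionalEquality
  using (_≡_; _≢_; _≗_; refl; cong; cong₂; sym; trans; subst; module ≡-Reasoning)
open import Relation.Nullary using (¬_; Dec; yes; no)

Word : Set
Word = List ℕ

data Head : Set where
  ⋆   : Head
  con : ℕ → Head

-- An element of the term model over unary function symbols: a head followed
-- by the function symbols applied to it, innermost first.
HTerm : Set
HTerm = Head × Word

_·_ : HTerm → Word → HTerm
(h , w) · u = h , w ++ u

·-identityʳ : ∀ a → a · [] ≡ a
·-identityʳ (h , w) = cong (h ,_) (++-identityʳ w)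

·-assoc : ∀ a u v → (a · u) · v ≡ a · (u ++ v)
·-assoc (h , w) u v = cong (h ,_) (++-assoc w u v)

head≟ : DecidableEquality Head
head≟ ⋆ ⋆ = yes refl
head≟ ⋆ (con _) = no λ ()
head≟ (con _) ⋆ = no λ ()
head≟ (con c) (con d) with c ≟ d
... | yes refl = yes refl
... | no c≢d = no λ { refl → c≢d refl }

hterm≟ : DecidableEquality HTerm
hterm≟ = Product.≡-dec head≟ (List.≡-dec _≟_)

-- Argument patterns: var· w is the atom's variable followed by w, gnd g a ground argument

data Arg : Set where
  var· : Word → Arg
  gnd  : HTerm → Arg

Pattern : Set
Pattern = List Arg

arg≟ : DecidableEquality Arg
arg≟ (var· u) (var· v) with List.≡-dec _≟_ u v
... | yes refl = yes refl
... | no u≢v = no λ { refl → u≢v refl }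
arg≟ (var· _) (gnd _) = no λ ()
arg≟ (gnd _) (var· _) = no λ ()
arg≟ (gnd a) (gnd b) with hterm≟ a b
... | yes refl = yes refl
... | no a≢b = no λ { refl → a≢b refl }

instArg : HTerm → Arg → HTerm
instArg a (var· w) = a · w
instArg a (gnd g) = g

instantiate : HTerm → Pattern → List HTerm
instantiate a = map (instArg a)

IsVar : Arg → Set
IsVar (var· _) = ⊤
IsVar (gnd _) = ⊥

IsGnd : Arg → Set
IsGnd (var· _) = ⊥
IsGnd (gnd _) = ⊤

HasVar : Pattern → Set
HasVar = Any IsVar

Ground : Pattern → Set
Ground = All IsGnd

hasVar? : ∀ p → HasVar p ⊎ Ground p
hasVar? [] = inj₂ []
hasVar? (var· _ ∷ p) = inj₁ (here tt)
hasVar? (gnd _ ∷ p) with hasVar? p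
... | inj₁ v = inj₁ (there v)
... | inj₂ g = inj₂ (tt ∷ g)

¬hasVar-ground : ∀ {p} → HasVar p → Ground p → ⊥
¬hasVar-ground {var· _ ∷ _} (here _) (() ∷ _)
¬hasVar-ground {_ ∷ _} (there v) (_ ∷ g) = ¬hasVar-ground v g

ground-instantiate : ∀ {p} a b → Ground p → instantiate a p ≡ instantiate b p
ground-instantiate a b [] = refl
ground-instantiate {gnd g ∷ p} a b (_ ∷ gp) = cong (g ∷_) (ground-instantiate a b gp)

-- Factoring out the longest common prefix of the variable arguments

StartsWith : ℕ → Arg → Set
StartsWith f (var· w) = Σ Word λ r → w ≡ f ∷ r
StartsWith f (gnd _) = ⊤

startsWith? : ∀ f a → Dec (StartsWith f a)
startsWith? f (var· []) = no λ { (_ , ()) }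
startsWith? f (var· (g ∷ r)) with f ≟ g
... | yes refl = yes (r , refl)
... | no f≢g = no λ { (_ , refl) → f≢g refl }
startsWith? f (gnd _) = yes tt

Reduced : Pattern → Set
Reduced p = ∀ f → ¬ All (StartsWith f) p

firstWord : Pattern → Word
firstWord [] = []
firstWord (var· w ∷ _) = w
firstWord (gnd _ ∷ p) = firstWord p

dropHead : Arg → Arg
dropHead (var· w) = var· (drop 1 w)
dropHead (gnd g) = gnd g

factor : ℕ → Pattern → Word × Pattern
factor zero p = [] , p
factor (suc n) p with firstWord p
... | [] = [] , p
... | f ∷ _ with all? (startsWith? f) p
...   | yes _ = map₁ (f ∷_) (factor n (map dropHead p))
...   | no _ = [] , p

dropHead-instantiate : ∀ {f} p a → All (StartsWith f) p →
  instantiate (a · [ f ]) (map dropHead p) ≡ instantiate a p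
dropHead-instantiate [] a [] = refl
dropHead-instantiate {f} (var· _ ∷ p) a ((r , refl) ∷ s) =
  cong₂ _∷_ (·-assoc a [ f ] r) (dropHead-instantiate p a s)
dropHead-instantiate (gnd g ∷ p) a (_ ∷ s) = cong (g ∷_) (dropHead-instantiate p a s)

firstWord-dropHead : ∀ p → firstWord (map dropHead p) ≡ drop 1 (firstWord p)
firstWord-dropHead [] = refl
firstWord-dropHead (var· w ∷ p) = refl
firstWord-dropHead (gnd g ∷ p) = firstWord-dropHead p

firstWord-ground : ∀ {p} → Ground p → firstWord p ≡ []
firstWord-ground [] = refl
firstWord-ground {gnd _ ∷ _} (_ ∷ g) = firstWord-ground g

dropHead-hasVar : ∀ {p} → HasVar p → HasVar (map dropHead p)
dropHead-hasVar {var· _ ∷ _} (here _) = here tt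
dropHead-hasVar (there v) = there (dropHead-hasVar v)

startsWith-firstWord : ∀ {f p} → HasVar p → All (StartsWith f) p → Σ Word λ r → firstWord p ≡ f ∷ r
startsWith-firstWord {p = var· _ ∷ _} (here _) ((r , refl) ∷ _) = r , refl
startsWith-firstWord {p = var· _ ∷ _} (there _) ((r , refl) ∷ _) = r , refl
startsWith-firstWord {p = gnd _ ∷ _} (there v) (_ ∷ s) = startsWith-firstWord v s

-- Only the first letter of the first variable argument can be common to all of them.
reduced-if-stuck : ∀ {p} → HasVar p → (∀ f r → firstWord p ≡ f ∷ r → ¬ All (StartsWith f) p) → Reduced p
reduced-if-stuck v stuck f s = let r , e = startsWith-firstWord v s in stuck f r e s

factor-instantiate : ∀ n p a →
  instantiate (a · proj₁ (factor n p)) (proj₂ (factor n p)) ≡ instantiate a p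
factor-instantiate zero p a = cong (λ b → instantiate b p) (·-identityʳ a)
factor-instantiate (suc n) p a with firstWord p
... | [] = cong (λ b → instantiate b p) (·-identityʳ a)
... | f ∷ _ with all? (startsWith? f) p
...   | no _ = cong (λ b → instantiate b p) (·-identityʳ a)
...   | yes s = begin
  instantiate (a · (f ∷ u)) p′        ≡⟨ cong (λ b → instantiate b p′) (·-assoc a [ f ] u) ⟨
  instantiate ((a · [ f ]) · u) p′    ≡⟨ factor-instantiate n (map dropHead p) (a · [ f ]) ⟩
  instantiate (a · [ f ]) (map dropHead p) ≡⟨ dropHead-instantiate p a s ⟩
  instantiate a p                     ∎
  where
  open ≡-Reasoning
  u = proj₁ (factor n (map dropHead p))
  p′ = proj₂ (factor n (map dropHead p))

factor-reduced : ∀ n p → HasVar p → length (firstWord p) ≤ n → Reduced (proj₂ (factor n p))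
factor-reduced zero p v le with firstWord p in eq
... | [] = reduced-if-stuck v λ f r e → case (trans (sym eq) e) of λ ()
factor-reduced (suc n) p v le with firstWord p in eq
... | [] = reduced-if-stuck v λ f r e → case (trans (sym eq) e) of λ ()
... | f ∷ r with all? (startsWith? f) p
...   | no ¬s = reduced-if-stuck v λ g r′ e s →
          ¬s (subst (λ h → All (StartsWith h) p) (sym (∷-injectiveˡ (trans (sym eq) e))) s)
...   | yes _ = factor-reduced n (map dropHead p) (dropHead-hasVar v) le′
  where
  le′ : length (firstWord (map dropHead p)) ≤ n
  le′ rewrite firstWord-dropHead p | eq = s≤s⁻¹ le

factor-hasVar : ∀ n p → HasVar p → HasVar (proj₂ (factor n p))
factor-hasVar zero p v = v
factor-hasVar (suc n) p v with firstWord p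
... | [] = v
... | f ∷ _ with all? (startsWith? f) p
...   | yes _ = factor-hasVar n (map dropHead p) (dropHead-hasVar v)
...   | no _ = v

factor-ground : ∀ n p → Ground p → factor n p ≡ ([] , p)
factor-ground zero p g = refl
factor-ground (suc n) p g rewrite firstWord-ground g = refl

factor-prefix : ∀ n p → Σ Word λ v → firstWord p ≡ proj₁ (factor n p) ++ v
factor-prefix zero p = firstWord p , refl
factor-prefix (suc n) p with firstWord p in eq
... | [] = [] , refl
... | f ∷ r with all? (startsWith? f) p
...   | no _ = f ∷ r , refl
...   | yes _ = let v , e = factor-prefix n (map dropHead p) in
  v , cong (f ∷_) (trans (sym (cong (drop 1) eq)) (trans (sym (firstWord-dropHead p)) e))

length-factor : ∀ n p → length (proj₂ (factor n p)) ≡ length p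
length-factor zero p = refl
length-factor (suc n) p with firstWord p
... | [] = refl
... | f ∷ _ with all? (startsWith? f) p
...   | yes _ = trans (length-factor n (map dropHead p)) (List.length-map dropHead p)
...   | no _ = refl

ArgAll : (Word → Set) → (HTerm → Set) → Arg → Set
ArgAll R Q (var· w) = R w
ArgAll R Q (gnd g) = Q g

module _ {R : Word → Set} {Q : HTerm → Set} (R-drop : ∀ {w} → R w → R (drop 1 w)) where

  dropHead-preserves : ∀ {p} → All (ArgAll R Q) p → All (ArgAll R Q) (map dropHead p)
  dropHead-preserves [] = []
  dropHead-preserves {var· _ ∷ _} (r ∷ a) = R-drop r ∷ dropHead-preserves a
  dropHead-preserves {gnd _ ∷ _} (q ∷ a) = q ∷ dropHead-preserves a

  factor-preserves : ∀ n p → All (ArgAll R Q) p → All (ArgAll R Q) (proj₂ (factor n p))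
  factor-preserves zero p a = a
  factor-preserves (suc n) p a with firstWord p
  ... | [] = a
  ... | f ∷ _ with all? (startsWith? f) p
  ...   | yes _ = factor-preserves n (map dropHead p) (dropHead-preserves a)
  ...   | no _ = a

-- The common prefix is a prefix of the first variable word, so its length is enough fuel.
prefix : Pattern → Word
prefix p = proj₁ (factor (length (firstWord p)) p)

reduct : Pattern → Pattern
reduct p = proj₂ (factor (length (firstWord p)) p)

reduct-instantiate : ∀ p a → instantiate (a · prefix p) (reduct p) ≡ instantiate a p
reduct-instantiate p = factor-instantiate (length (firstWord p)) p

reduct-reduced : ∀ p → HasVar p → Reduced (reduct p)
reduct-reduced p v = factor-reduced (length (firstWord p)) p v ≤-refl

reduct-hasVar : ∀ p → HasVar p → HasVar (reduct p)
reduct-hasVar p = factor-hasVar (length (firstWord p)) p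

reduct-ground : ∀ p → Ground p → reduct p ≡ p
reduct-ground p g = cong proj₂ (factor-ground (length (firstWord p)) p g)

length-reduct : ∀ p → length (reduct p) ≡ length p
length-reduct p = length-factor (length (firstWord p)) p

prefix-firstWord : ∀ p → Σ Word λ v → firstWord p ≡ prefix p ++ v
prefix-firstWord p = factor-prefix (length (firstWord p)) p

reduct-preserves : ∀ {R Q} → (∀ {w} → R w → R (drop 1 w)) → ∀ p → All (ArgAll R Q) p → All (ArgAll R Q) (reduct p)
reduct-preserves R-drop p = factor-preserves R-drop (length (firstWord p)) p

dropSuffix : ℕ → HTerm → HTerm
dropSuffix n (h , v) = h , take (length v ∸ n) v

take-length-++ : ∀ (v w : Word) → take (length v) (v ++ w) ≡ v
take-length-++ [] w = refl
take-length-++ (x ∷ v) w = cong (x ∷_) (take-length-++ v w)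

dropSuffix-· : ∀ a w → dropSuffix (length w) (a · w) ≡ a
dropSuffix-· (h , v) w = cong (h ,_) (begin
  take (length (v ++ w) ∸ length w) (v ++ w)   ≡⟨ cong (λ n → take (n ∸ length w) (v ++ w)) (length-++ v) ⟩
  take (length v + length w ∸ length w) (v ++ w) ≡⟨ cong (λ n → take n (v ++ w)) (m+n∸n≡m (length v) (length w)) ⟩
  take (length v) (v ++ w)                     ≡⟨ take-length-++ v w ⟩
  v                                            ∎)
  where open ≡-Reasoning

-- The only a that can satisfy instantiate a p ≡ τ when p has a variable argument.
candidate : Pattern → List HTerm → HTerm
candidate (var· w ∷ _) (t ∷ _) = dropSuffix (length w) t
candidate (gnd _ ∷ p) (_ ∷ τ) = candidate p τ
candidate _ _ = ⋆ , []

match : Pattern → List HTerm → Maybe HTerm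
match p τ with List.≡-dec hterm≟ (instantiate (candidate p τ) p) τ
... | yes _ = just (candidate p τ)
... | no _ = nothing

match-sound : ∀ p τ {a} → match p τ ≡ just a → a ≡ candidate p τ × instantiate a p ≡ τ
match-sound p τ eq with List.≡-dec hterm≟ (instantiate (candidate p τ) p) τ
match-sound p τ refl | yes inst≡τ = refl , inst≡τ

candidate-instantiate : ∀ {p} a → HasVar p → candidate p (instantiate a p) ≡ a
candidate-instantiate {var· w ∷ _} a _ = dropSuffix-· a w
candidate-instantiate {gnd _ ∷ _} a (there v) = candidate-instantiate a v

match-complete : ∀ p τ → instantiate (candidate p τ) p ≡ τ → match p τ ≡ just (candidate p τ)
match-complete p τ inst≡τ with List.≡-dec hterm≟ (instantiate (candidate p τ) p) τ
... | yes _ = refl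
... | no ne = ⊥-elim (ne inst≡τ)

match-candidate-instance : ∀ p a → match p (instantiate a p) ≡ just (candidate p (instantiate a p))
match-candidate-instance p a = match-complete p _ (candidate-instantiates (hasVar? p))
  where
  candidate-instantiates : HasVar p ⊎ Ground p → instantiate (candidate p (instantiate a p)) p ≡ instantiate a p
  candidate-instantiates (inj₁ v) = cong (λ b → instantiate b p) (candidate-instantiate a v)
  candidate-instantiates (inj₂ g) = ground-instantiate _ a g

match-instantiate : ∀ p a → HasVar p → match p (instantiate a p) ≡ just a
match-instantiate p a v = trans (match-candidate-instance p a) (cong just (candidate-instantiate a v))

Template : Set
Template = ℕ × ℕ × Pattern

template≟ : DecidableEquality Template
template≟ = Product.≡-dec _≟_ (Product.≡-dec _≟_ (List.≡-dec arg≟))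

pattern-of : Template → Pattern
pattern-of (_ , _ , p) = p

matchTemplate : Template → ℕ → ℕ → List HTerm → Maybe HTerm
matchTemplate (P′ , k′ , p) P k τ with P′ ≟ P | k′ ≟ k
... | yes _ | yes _ = match p τ
... | _     | _     = nothing

matchTemplate-sound : ∀ P′ k′ p P k τ {a} → matchTemplate (P′ , k′ , p) P k τ ≡ just a →
  P′ ≡ P × k′ ≡ k × match p τ ≡ just a
matchTemplate-sound P′ k′ p P k τ eq with P′ ≟ P | k′ ≟ k
... | yes P′≡P | yes k′≡k = P′≡P , k′≡k , eq

matchTemplate-self : ∀ P k p τ → matchTemplate (P , k , p) P k τ ≡ match p τ
matchTemplate-self P k p τ with P ≟ P | k ≟ k
... | yes _ | yes _ = refl
... | no ne | _ = ⊥-elim (ne refl)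
... | yes _ | no ne = ⊥-elim (ne refl)

lookup? : {A : Set} → List A → ℕ → Maybe A
lookup? [] i = nothing
lookup? (x ∷ xs) zero = just x
lookup? (x ∷ xs) (suc i) = lookup? xs i

module _ {A : Set} (_≟A_ : DecidableEquality A) where

  indexOf : List A → A → ℕ
  indexOf [] x = 0
  indexOf (y ∷ ys) x with y ≟A x
  ... | yes _ = 0
  ... | no _ = suc (indexOf ys x)

  lookup-indexOf : ∀ {xs x} → x ∈ xs → lookup? xs (indexOf xs x) ≡ just x
  lookup-indexOf {y ∷ ys} {x} x∈xs with y ≟A x
  ... | yes refl = refl
  lookup-indexOf (here refl) | no y≢x = ⊥-elim (y≢x refl)
  lookup-indexOf (there x∈ys) | no _ = lookup-indexOf x∈ys

firstMatch : List Template → ℕ → ℕ → List HTerm → Maybe (ℕ × HTerm)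
firstMatch [] P k τ = nothing
firstMatch (e ∷ G) P k τ with matchTemplate e P k τ
... | just a = just (0 , a)
... | nothing = Maybe.map (map₁ suc) (firstMatch G P k τ)

firstMatch-sound : ∀ G P k τ {i a} → firstMatch G P k τ ≡ just (i , a) →
  Σ Pattern λ p → lookup? G i ≡ just (P , k , p) × match p τ ≡ just a
firstMatch-sound ((P′ , k′ , p) ∷ G) P k τ eq with matchTemplate (P′ , k′ , p) P k τ in m
firstMatch-sound ((P′ , k′ , p) ∷ G) P k τ refl | just _
  with refl , refl , m′ ← matchTemplate-sound P′ k′ p P k τ m = p , refl , m′
... | nothing with firstMatch G P k τ in eq′
firstMatch-sound (_ ∷ G) P k τ refl | nothing | just _ = firstMatch-sound G P k τ eq′

firstMatch-complete : ∀ G P k τ n p {a} → lookup? G n ≡ just (P , k , p) → match p τ ≡ just a →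
  Σ (ℕ × HTerm) λ r → firstMatch G P k τ ≡ just r
firstMatch-complete (e ∷ G) P k τ n p lk m with matchTemplate e P k τ in m′
... | just b = (0 , b) , refl
firstMatch-complete (e ∷ G) P k τ zero p refl m | nothing
  rewrite matchTemplate-self P k p τ with () ← trans (sym m′) m
firstMatch-complete (e ∷ G) P k τ (suc n) p lk m | nothing =
  let r , eq = firstMatch-complete G P k τ n p lk m in map₁ suc r , cong (Maybe.map (map₁ suc)) eq

firstMatch-unique : ∀ G P k τ p {a} → (P , k , p) ∈ G → match p τ ≡ just a →
  (∀ e → e ∈ G → e ≢ (P , k , p) → ∀ b → matchTemplate e P k τ ≢ just b) →
  firstMatch G P k τ ≡ just (indexOf template≟ G (P , k , p) , a)
firstMatch-unique (e ∷ G) P k τ p p∈G m others with template≟ e (P , k , p)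
... | yes refl rewrite matchTemplate-self P k p τ | m = refl
... | no e≢ with matchTemplate e P k τ in m′
...   | just b = ⊥-elim (others e (here refl) e≢ b m′)
...   | nothing with p∈G
...     | here refl = ⊥-elim (e≢ refl)
...     | there p∈G′ rewrite firstMatch-unique G P k τ p p∈G′ m (λ e′ e′∈G → others e′ (there e′∈G)) = refl

-- Two distinct reduced patterns can only share an instance at special elements

IsCon : HTerm → Set
IsCon (⋆ , _) = ⊥
IsCon (con _ , _) = ⊤

isCon? : ∀ a → Dec (IsCon a)
isCon? (⋆ , _) = no λ ()
isCon? (con _ , _) = yes tt

con-· : ∀ {a} w → IsCon a → IsCon (a · w)
con-· {con _ , _} w _ = tt

con-·⁻ : ∀ {a} w → IsCon (a · w) → IsCon a
con-·⁻ {con _ , _} w _ = tt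

ConGround : Pattern → Set
ConGround = All (ArgAll (λ _ → ⊤) IsCon)

instantiate-con : ∀ {a p} → IsCon a → ConGround p → All IsCon (instantiate a p)
instantiate-con c [] = []
instantiate-con {p = var· w ∷ _} c (_ ∷ g) = con-· w c ∷ instantiate-con c g
instantiate-con {p = gnd _ ∷ _} c (q ∷ g) = q ∷ instantiate-con c g

con-instantiate : ∀ {e p} → HasVar p → All IsCon (instantiate e p) → IsCon e
con-instantiate {p = var· w ∷ _} _ (c ∷ _) = con-·⁻ w c
con-instantiate {p = gnd _ ∷ _} (there v) (_ ∷ cs) = con-instantiate v cs

SameShape : Pattern → Pattern → Set
SameShape [] [] = ⊤
SameShape (var· _ ∷ q) (var· _ ∷ q′) = SameShape q q′
SameShape (gnd _ ∷ q) (gnd _ ∷ q′) = SameShape q q′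
SameShape _ _ = ⊥

sameShape-hasVar : ∀ {q q′} → SameShape q q′ → HasVar q → HasVar q′
sameShape-hasVar {var· _ ∷ _} {var· _ ∷ _} s (here _) = here tt
sameShape-hasVar {var· _ ∷ _} {var· _ ∷ _} s (there v) = there (sameShape-hasVar s v)
sameShape-hasVar {gnd _ ∷ _} {gnd _ ∷ _} s (there v) = there (sameShape-hasVar s v)

-- The elements e at which instantiate e p may equal an instance of p′, read off the first
-- position where one pattern has the variable and the other a ground argument.
clashes : (p p′ q q′ : Pattern) → List HTerm
clashes p p′ (var· w ∷ q) (gnd g ∷ q′) = dropSuffix (length w) g ∷ clashes p p′ q q′
clashes p p′ (gnd g ∷ q) (var· w′ ∷ q′) =
  fromMaybe (match p (instantiate (dropSuffix (length w′) g) p′)) ++ clashes p p′ q q′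
clashes p p′ (_ ∷ q) (_ ∷ q′) = clashes p p′ q q′
clashes p p′ _ _ = []

clashCandidates : Pattern → Pattern → List HTerm
clashCandidates p p′ = clashes p p′ p p′

module _ {p p′ : Pattern} {a e : HTerm} (a·p′≡e·p : instantiate a p′ ≡ instantiate e p)
         (p-var : HasVar p) (p-con : ConGround p) (p′-con : ConGround p′) where

  sameShape-or-clash : ∀ q q′ → instantiate a q′ ≡ instantiate e q → ConGround q → ConGround q′ →
    SameShape q q′ ⊎ (IsCon e × e ∈ clashes p p′ q q′)
  sameShape-or-clash [] [] eq _ _ = inj₁ tt
  sameShape-or-clash (var· w ∷ q) (gnd g ∷ q′) eq _ (g-con ∷ _) with refl ← ∷-injectiveˡ eq =
    inj₂ (con-·⁻ w g-con , here (sym (dropSuffix-· e w)))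
  sameShape-or-clash (gnd g ∷ q) (var· w′ ∷ q′) eq (g-con ∷ _) _ with refl ← ∷-injectiveˡ eq =
    inj₂ (e-con , ∈-++⁺ˡ e∈)
    where
    e-con : IsCon e
    e-con = con-instantiate p-var (subst (All IsCon) a·p′≡e·p (instantiate-con (con-·⁻ w′ g-con) p′-con))
    e∈ : e ∈ fromMaybe (match p (instantiate (dropSuffix (length w′) (a · w′)) p′))
    e∈ rewrite dropSuffix-· a w′ | a·p′≡e·p | match-instantiate p e p-var = here refl
  sameShape-or-clash (var· _ ∷ q) (var· _ ∷ q′) eq (_ ∷ c) (_ ∷ c′) =
    sameShape-or-clash q q′ (List.∷-injectiveʳ eq) c c′
  sameShape-or-clash (gnd _ ∷ q) (gnd _ ∷ q′) eq (_ ∷ c) (_ ∷ c′) =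
    sameShape-or-clash q q′ (List.∷-injectiveʳ eq) c c′

Aligned : Word → Word → Pattern → Pattern → Set
Aligned u v [] [] = ⊤
Aligned u v (var· w ∷ q) (var· w′ ∷ q′) = (u ++ w′ ≡ v ++ w) × Aligned u v q q′
Aligned u v (gnd g ∷ q) (gnd g′ ∷ q′) = (g′ ≡ g) × Aligned u v q q′
Aligned u v _ _ = ⊥

aligned : ∀ {h u h′ v} q q′ → SameShape q q′ → instantiate (h , u) q′ ≡ instantiate (h′ , v) q → Aligned u v q q′
aligned [] [] _ _ = tt
aligned (var· _ ∷ q) (var· _ ∷ q′) s eq =
  let e , es = ∷-injective eq in cong proj₂ e , aligned q q′ s es
aligned (gnd _ ∷ q) (gnd _ ∷ q′) s eq =
  let e , es = ∷-injective eq in e , aligned q q′ s es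

aligned-tail : ∀ {f u v} q q′ → Aligned (f ∷ u) (f ∷ v) q q′ → Aligned u v q q′
aligned-tail [] [] _ = tt
aligned-tail (var· _ ∷ q) (var· _ ∷ q′) (e , al) = List.∷-injectiveʳ e , aligned-tail q q′ al
aligned-tail (gnd _ ∷ q) (gnd _ ∷ q′) (e , al) = e , aligned-tail q q′ al

aligned-head : ∀ {f g u v} q q′ → HasVar q → Aligned (f ∷ u) (g ∷ v) q q′ → f ≡ g
aligned-head (var· _ ∷ q) (var· _ ∷ q′) _ (e , _) = ∷-injectiveˡ e
aligned-head (gnd _ ∷ q) (gnd _ ∷ q′) (there v) (_ , al) = aligned-head q q′ v al

aligned-startsˡ : ∀ {f u} q q′ → Aligned (f ∷ u) [] q q′ → All (StartsWith f) q
aligned-startsˡ [] [] _ = []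
aligned-startsˡ {u = u} (var· _ ∷ q) (var· w′ ∷ q′) (e , al) = (u ++ w′ , sym e) ∷ aligned-startsˡ q q′ al
aligned-startsˡ (gnd _ ∷ q) (gnd _ ∷ q′) (_ , al) = tt ∷ aligned-startsˡ q q′ al

aligned-startsʳ : ∀ {f v} q q′ → Aligned [] (f ∷ v) q q′ → All (StartsWith f) q′
aligned-startsʳ [] [] _ = []
aligned-startsʳ {v = v} (var· w ∷ q) (var· _ ∷ q′) (e , al) = (v ++ w , e) ∷ aligned-startsʳ q q′ al
aligned-startsʳ (gnd _ ∷ q) (gnd _ ∷ q′) (_ , al) = tt ∷ aligned-startsʳ q q′ al

aligned-reduced : ∀ u v q q′ → Aligned u v q q′ → HasVar q → Reduced q → Reduced q′ → u ≡ v
aligned-reduced [] [] q q′ al _ _ _ = refl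
aligned-reduced (f ∷ u) [] q q′ al _ red _ = ⊥-elim (red f (aligned-startsˡ q q′ al))
aligned-reduced [] (f ∷ v) q q′ al _ _ red′ = ⊥-elim (red′ f (aligned-startsʳ q q′ al))
aligned-reduced (f ∷ u) (g ∷ v) q q′ al hv red red′ with refl ← aligned-head q q′ hv al =
  cong (f ∷_) (aligned-reduced u v q q′ (aligned-tail q q′ al) hv red red′)

aligned-≡ : ∀ u q q′ → Aligned u u q q′ → q′ ≡ q
aligned-≡ u [] [] _ = refl
aligned-≡ u (var· w ∷ q) (var· w′ ∷ q′) (e , al) = cong₂ _∷_ (cong var· (++-cancelˡ u w′ w e)) (aligned-≡ u q q′ al)
aligned-≡ u (gnd _ ∷ q) (gnd _ ∷ q′) (e , al) = cong₂ _∷_ (cong gnd e) (aligned-≡ u q q′ al)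

-- Reduced patterns with the same shape sharing an instance are equal, so distinct ones clash.
distinct-patterns-clash : ∀ p p′ a e → instantiate a p′ ≡ instantiate e p →
  HasVar p → Reduced p → (HasVar p′ → Reduced p′) → ConGround p → ConGround p′ → p′ ≢ p →
  IsCon e × e ∈ clashCandidates p p′
distinct-patterns-clash p p′ a@(_ , u) e@(_ , v) eq hv red red′ c c′ p′≢p
  with sameShape-or-clash eq hv c c′ p p′ eq c c′
... | inj₂ clash = clash
... | inj₁ same = ⊥-elim (p′≢p (aligned-≡ u p p′ (subst (λ w → Aligned u w p p′) (sym u≡v) al)))
  where
  al = aligned p p′ same eq
  u≡v = aligned-reduced u v p p′ al hv red (red′ (sameShape-hasVar same hv))

data Shape : Set where
  varShape : ℕ → Word → Shape
  gndShape : HTerm → Shape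

_▸_ : Shape → ℕ → Shape
varShape x w ▸ f = varShape x (w ++ [ f ])
gndShape a ▸ f = gndShape (a · [ f ])

-- The last clause is junk: the fragment has no function symbol of arity > 1.
shape : Term → Shape
shape (var x) = varShape x []
shape (app f zero []) = gndShape (con f , [])
shape (app f (suc zero) (t ∷ [])) = shape t ▸ f
shape (app f (suc (suc k)) ts) = gndShape (con f , [])

argOf : Shape → Arg
argOf (varShape _ w) = var· w
argOf (gndShape a) = gnd a

rawPattern : ∀ {k} → Vec Term k → Pattern
rawPattern [] = []
rawPattern (t ∷ ts) = argOf (shape t) ∷ rawPattern ts

prefixOf : ∀ {k} → Vec Term k → Word
prefixOf ts = prefix (rawPattern ts)

patternOf : ∀ {k} → Vec Term k → Pattern
patternOf ts = reduct (rawPattern ts)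

templateOf : (P k : ℕ) → Vec Term k → Template
templateOf P k ts = P , k , patternOf ts

templates : Formula → List Template
templates (lit _ P k ts) = templateOf P k ts ∷ []
templates (φ ∧' ψ) = templates φ ++ templates ψ
templates (φ ∨' ψ) = templates φ ++ templates ψ
templates (all' _ φ) = templates φ
templates (ex' _ φ) = templates φ

clashesWith : List Template → Template → List HTerm
clashesWith G e = concatMap (λ e′ → clashCandidates (pattern-of e) (pattern-of e′)) G

specials : List Template → List HTerm
specials G = filter isCon? (concatMap (clashesWith G) G)

-- The new predicate symbols: 2i for the i-th template, 2j+1 for the j-th special element.
patternPred : ℕ → ℕ
patternPred i = i + i

specialPred : ℕ → ℕ
specialPred j = suc (j + j)

applyWord : Term → Word → Term
applyWord t [] = t
applyWord t (f ∷ w) = applyWord (app f 1 (t ∷ [])) w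

-- ⋆ is rendered as the variable 0, which canonicalLit binds; special elements never have head ⋆.
⌜_⌝ : HTerm → Term
⌜ ⋆ , w ⌝ = applyWord (var 0) w
⌜ con c , w ⌝ = applyWord (app c 0 []) w

bigAnd : (HTerm → Formula) → Formula → List HTerm → Formula
bigAnd c base [] = base
bigAnd c base (g ∷ gs) = c g ∧' bigAnd c base gs

canonicalLit : List Template → Bool → ℕ → ℕ → List HTerm → Formula
canonicalLit G s P k τ with firstMatch G P k τ
... | just (i , a) = all' 0 (lit s (patternPred i) 1 (⌜ a ⌝ ∷ []))
... | nothing = all' 0 (lit s 0 1 (var 0 ∷ []))

module Translation (G : List Template) (S : List HTerm) where

  isSpecial : Bool → HTerm → Term → Formula
  isSpecial s g t = lit s (specialPred (indexOf hterm≟ S g)) 1 (t ∷ [])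

  guarded : Bool → ℕ → ℕ → Pattern → Term → HTerm → Formula
  guarded s P k p t g = isSpecial false g t ∨' canonicalLit G s P k (instantiate g p)

  translateLit : Bool → (P k : ℕ) → Vec Term k → Formula
  translateLit s P k ts with varsTs ts
  ... | [] = canonicalLit G s P k (instantiate (⋆ , []) (patternOf ts))
  ... | x ∷ _ = bigAnd (guarded s P k (patternOf ts) xu)
                       (lit s (patternPred (indexOf template≟ G (templateOf P k ts))) 1 (xu ∷ [])) S
    where xu = applyWord (var x) (prefixOf ts)

  axiom : HTerm → Formula
  axiom g = isSpecial true g ⌜ g ⌝

mapLits : (Bool → (P k : ℕ) → Vec Term k → Formula) → Formula → Formula
mapLits tr (lit s P k ts) = tr s P k ts
mapLits tr (φ ∧' ψ) = mapLits tr φ ∧' mapLits tr ψ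
mapLits tr (φ ∨' ψ) = mapLits tr φ ∨' mapLits tr ψ
mapLits tr (all' x φ) = all' x (mapLits tr φ)
mapLits tr (ex' x φ) = ex' x (mapLits tr φ)

translate : Formula → Formula
translate φ = bigAnd axiom (mapLits translateLit φ) S
  where
  G = templates φ
  S = specials G
  open Translation G S

Preds : Set₁
Preds = ℕ → (k : ℕ) → Vec HTerm k → Set

-- The last clause is junk: the fragment has no function symbol of arity > 1.
applyFun : ℕ → (k : ℕ) → Vec HTerm k → HTerm
applyFun f zero [] = con f , []
applyFun f (suc zero) (a ∷ []) = a · [ f ]
applyFun f (suc (suc k)) _ = ⋆ , []

termStructure : Preds → Structure
termStructure pr = record { D = HTerm ; elem = ⋆ , [] ; fun = applyFun ; pred = pr }

ρ⋆ : ℕ → HTerm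
ρ⋆ _ = ⋆ , []

UnaryTerm : Term → Set
UnaryTerm (var _) = ⊤
UnaryTerm (app _ zero _) = ⊤
UnaryTerm (app _ (suc zero) (t ∷ [])) = UnaryTerm t
UnaryTerm (app _ (suc (suc _)) _) = ⊥

UnaryTerms : ∀ {k} → Vec Term k → Set
UnaryTerms = VecAll.All UnaryTerm

evalShape : (ℕ → HTerm) → Shape → HTerm
evalShape ρ (varShape x w) = ρ x · w
evalShape ρ (gndShape a) = a

ShapeVars : Term → Shape → Set
ShapeVars t (varShape x _) = varsT t ≡ [ x ]
ShapeVars t (gndShape _) = varsT t ≡ []

ConShape : Shape → Set
ConShape (varShape _ _) = ⊤
ConShape (gndShape a) = IsCon a

shape-vars : ∀ t → UnaryTerm t → ShapeVars t (shape t)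
shape-vars (var x) _ = refl
shape-vars (app f zero []) _ = refl
shape-vars (app f (suc zero) (t ∷ [])) u with shape t | shape-vars t u
... | varShape _ _ | e = trans (++-identityʳ (varsT t)) e
... | gndShape _ | e = trans (++-identityʳ (varsT t)) e

shape-con : ∀ t → ConShape (shape t)
shape-con (var x) = tt
shape-con (app f zero []) = tt
shape-con (app f (suc zero) (t ∷ [])) with shape t | shape-con t
... | varShape _ _ | _ = tt
... | gndShape a | c = con-· [ _ ] c
shape-con (app f (suc (suc k)) ts) = tt

rawPattern-con : ∀ {k} (ts : Vec Term k) → ConGround (rawPattern ts)
rawPattern-con [] = []
rawPattern-con (t ∷ ts) with shape t | shape-con t
... | varShape _ _ | _ = tt ∷ rawPattern-con ts
... | gndShape _ | c = c ∷ rawPattern-con ts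

rawPattern-ground : ∀ {k} {ts : Vec Term k} → UnaryTerms ts → varsTs ts ≡ [] → Ground (rawPattern ts)
rawPattern-ground [] _ = []
rawPattern-ground {ts = t ∷ ts} (u ∷ us) e with shape t | shape-vars t u
... | varShape _ _ | e′ rewrite e′ with () ← e
... | gndShape _ | e′ rewrite e′ = tt ∷ rawPattern-ground us e

rawPattern-hasVar : ∀ {k} {ts : Vec Term k} {x r} → UnaryTerms ts → varsTs ts ≡ x ∷ r → HasVar (rawPattern ts)
rawPattern-hasVar {ts = t ∷ ts} (u ∷ us) e with shape t | shape-vars t u
... | varShape _ _ | _ = here tt
... | gndShape _ | e′ rewrite e′ = there (rawPattern-hasVar us e)

patternOf-ground : ∀ {k} {ts : Vec Term k} → UnaryTerms ts → varsTs ts ≡ [] → patternOf ts ≡ rawPattern ts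
patternOf-ground {ts = ts} us e = reduct-ground (rawPattern ts) (rawPattern-ground us e)

patternOf-hasVar : ∀ {k} {ts : Vec Term k} {x r} → UnaryTerms ts → varsTs ts ≡ x ∷ r → HasVar (patternOf ts)
patternOf-hasVar {ts = ts} us e = reduct-hasVar (rawPattern ts) (rawPattern-hasVar us e)

module _ (pr : Preds) where
  private T = termStructure pr

  eval-applyWord : ∀ ρ t w → evalT T ρ (applyWord t w) ≡ evalT T ρ t · w
  eval-applyWord ρ t [] = sym (·-identityʳ _)
  eval-applyWord ρ t (f ∷ w) = trans (eval-applyWord ρ (app f 1 (t ∷ [])) w) (·-assoc (evalT T ρ t) [ f ] w)

  eval-⌜⌝-con : ∀ ρ g → IsCon g → evalT T ρ ⌜ g ⌝ ≡ g
  eval-⌜⌝-con ρ (con c , w) _ = eval-applyWord ρ (app c 0 []) w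

  eval-⌜⌝-⋆ : ∀ ρ g → ρ 0 ≡ (⋆ , []) → evalT T ρ ⌜ g ⌝ ≡ g
  eval-⌜⌝-⋆ ρ (con c , w) _ = eval-applyWord ρ (app c 0 []) w
  eval-⌜⌝-⋆ ρ (⋆ , w) ρ0≡⋆ = trans (eval-applyWord ρ (var 0) w) (cong (_· w) ρ0≡⋆)

  eval-shape : ∀ ρ t → UnaryTerm t → evalT T ρ t ≡ evalShape ρ (shape t)
  eval-shape ρ (var x) _ = sym (·-identityʳ (ρ x))
  eval-shape ρ (app f zero []) _ = refl
  eval-shape ρ (app f (suc zero) (t ∷ [])) u rewrite eval-shape ρ t u with shape t
  ... | varShape x w = ·-assoc (ρ x) w [ f ]
  ... | gndShape _ = refl

  eval-arg : ∀ ρ x t → UnaryTerm t → All (_≡ x) (varsT t) → evalT T ρ t ≡ instArg (ρ x) (argOf (shape t))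
  eval-arg ρ x t u xs rewrite eval-shape ρ t u with shape t | shape-vars t u
  ... | varShape y w | e with subst (All (_≡ x)) e xs
  ...   | refl ∷ [] = refl
  eval-arg ρ x t u xs | gndShape _ | _ = refl

  eval-args : ∀ ρ x {k} (ts : Vec Term k) → UnaryTerms ts → All (_≡ x) (varsTs ts) →
    toList (evalTs T ρ ts) ≡ instantiate (ρ x) (rawPattern ts)
  eval-args ρ x [] _ _ = refl
  eval-args ρ x (t ∷ ts) (u ∷ us) xs =
    let xs₁ , xs₂ = AllP.++⁻ (varsT t) xs in
    cong₂ _∷_ (eval-arg ρ x t u xs₁) (eval-args ρ x ts us xs₂)

  eval-args-prefix : ∀ ρ x {k} (ts : Vec Term k) → UnaryTerms ts → All (_≡ x) (varsTs ts) →
    toList (evalTs T ρ ts) ≡ instantiate (evalT T ρ (applyWord (var x) (prefixOf ts))) (patternOf ts)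
  eval-args-prefix ρ x ts us xs = begin
    toList (evalTs T ρ ts)                                   ≡⟨ eval-args ρ x ts us xs ⟩
    instantiate (ρ x) (rawPattern ts)                        ≡⟨ reduct-instantiate (rawPattern ts) (ρ x) ⟨
    instantiate (ρ x · prefixOf ts) (patternOf ts)
      ≡⟨ cong (λ a → instantiate a (patternOf ts)) (eval-applyWord ρ (var x) (prefixOf ts)) ⟨
    instantiate (evalT T ρ (applyWord (var x) (prefixOf ts))) (patternOf ts) ∎
    where open ≡-Reasoning

  eval-args-ground : ∀ ρ {k} (ts : Vec Term k) → UnaryTerms ts → varsTs ts ≡ [] →
    toList (evalTs T ρ ts) ≡ instantiate (⋆ , []) (patternOf ts)
  eval-args-ground ρ ts us e = begin
    toList (evalTs T ρ ts)                ≡⟨ eval-args ρ 0 ts us (subst (All (_≡ 0)) (sym e) []) ⟩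
    instantiate (ρ 0) (rawPattern ts)     ≡⟨ ground-instantiate (ρ 0) (⋆ , []) (rawPattern-ground us e) ⟩
    instantiate (⋆ , []) (rawPattern ts)  ≡⟨ cong (instantiate (⋆ , [])) (patternOf-ground us e) ⟨
    instantiate (⋆ , []) (patternOf ts)   ∎
    where open ≡-Reasoning

AllLits : (Bool → (P k : ℕ) → Vec Term k → Set) → Formula → Set
AllLits Q (lit s P k ts) = Q s P k ts
AllLits Q (φ ∧' ψ) = AllLits Q φ × AllLits Q ψ
AllLits Q (φ ∨' ψ) = AllLits Q φ × AllLits Q ψ
AllLits Q (all' _ φ) = AllLits Q φ
AllLits Q (ex' _ φ) = AllLits Q φ

AllAtoms-zip : ∀ {Q Q′ : (P k : ℕ) → Vec Term k → Set} φ → AllAtoms Q φ → AllAtoms Q′ φ →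
  AllAtoms (λ P k ts → Q P k ts × Q′ P k ts) φ
AllAtoms-zip (lit s P k ts) q q′ = q , q′
AllAtoms-zip (φ ∧' ψ) (q₁ , q₂) (q₁′ , q₂′) = AllAtoms-zip φ q₁ q₁′ , AllAtoms-zip ψ q₂ q₂′
AllAtoms-zip (φ ∨' ψ) (q₁ , q₂) (q₁′ , q₂′) = AllAtoms-zip φ q₁ q₁′ , AllAtoms-zip ψ q₂ q₂′
AllAtoms-zip (all' _ φ) q q′ = AllAtoms-zip φ q q′
AllAtoms-zip (ex' _ φ) q q′ = AllAtoms-zip φ q q′

AllAtoms⇒AllLits : ∀ {Q : (P k : ℕ) → Vec Term k → Set} {Q′ : Bool → (P k : ℕ) → Vec Term k → Set} →
  (∀ {s P k ts} → Q P k ts → Q′ s P k ts) → ∀ φ → AllAtoms Q φ → AllLits Q′ φ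
AllAtoms⇒AllLits f (lit s P k ts) q = f q
AllAtoms⇒AllLits f (φ ∧' ψ) (q , q′) = AllAtoms⇒AllLits f φ q , AllAtoms⇒AllLits f ψ q′
AllAtoms⇒AllLits f (φ ∨' ψ) (q , q′) = AllAtoms⇒AllLits f φ q , AllAtoms⇒AllLits f ψ q′
AllAtoms⇒AllLits f (all' _ φ) q = AllAtoms⇒AllLits f φ q
AllAtoms⇒AllLits f (ex' _ φ) q = AllAtoms⇒AllLits f φ q

allLits : ∀ {Q : Bool → (P k : ℕ) → Vec Term k → Set} → (∀ s P k ts → Q s P k ts) → ∀ φ → AllLits Q φ
allLits q (lit s P k ts) = q s P k ts
allLits q (φ ∧' ψ) = allLits q φ , allLits q ψ
allLits q (φ ∨' ψ) = allLits q φ , allLits q ψ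
allLits q (all' _ φ) = allLits q φ
allLits q (ex' _ φ) = allLits q φ

mapLits-lit : ∀ φ → mapLits lit φ ≡ φ
mapLits-lit (lit s P k ts) = refl
mapLits-lit (φ ∧' ψ) = cong₂ _∧'_ (mapLits-lit φ) (mapLits-lit ψ)
mapLits-lit (φ ∨' ψ) = cong₂ _∨'_ (mapLits-lit φ) (mapLits-lit ψ)
mapLits-lit (all' x φ) = cong (all' x) (mapLits-lit φ)
mapLits-lit (ex' x φ) = cong (ex' x) (mapLits-lit φ)

module _ (M : Structure) where
  open Structure M

  update-cong : ∀ {ρ ρ′ : ℕ → D} → ρ ≗ ρ′ → ∀ x d → update M ρ x d ≗ update M ρ′ x d
  update-cong ρ≗ρ′ x d y with y ≟ x
  ... | yes _ = refl
  ... | no _ = ρ≗ρ′ y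

  eval-cong : ∀ {ρ ρ′ : ℕ → D} → ρ ≗ ρ′ → ∀ t → evalT M ρ t ≡ evalT M ρ′ t
  evals-cong : ∀ {ρ ρ′ : ℕ → D} → ρ ≗ ρ′ → ∀ {k} (ts : Vec Term k) → evalTs M ρ ts ≡ evalTs M ρ′ ts
  eval-cong ρ≗ρ′ (var x) = ρ≗ρ′ x
  eval-cong ρ≗ρ′ (app f k ts) = cong (fun f k) (evals-cong ρ≗ρ′ ts)
  evals-cong ρ≗ρ′ [] = refl
  evals-cong ρ≗ρ′ (t ∷ ts) = cong₂ _∷_ (eval-cong ρ≗ρ′ t) (evals-cong ρ≗ρ′ ts)

  holds-cong : ∀ φ {ρ ρ′ : ℕ → D} → ρ ≗ ρ′ → Holds M ρ φ → Holds M ρ′ φ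
  holds-cong (lit true P k ts) ρ≗ρ′ h = subst (pred P k) (evals-cong ρ≗ρ′ ts) h
  holds-cong (lit false P k ts) ρ≗ρ′ h p = h (subst (pred P k) (sym (evals-cong ρ≗ρ′ ts)) p)
  holds-cong (φ ∧' ψ) ρ≗ρ′ (h , h′) = holds-cong φ ρ≗ρ′ h , holds-cong ψ ρ≗ρ′ h′
  holds-cong (φ ∨' ψ) ρ≗ρ′ (inj₁ h) = inj₁ (holds-cong φ ρ≗ρ′ h)
  holds-cong (φ ∨' ψ) ρ≗ρ′ (inj₂ h) = inj₂ (holds-cong ψ ρ≗ρ′ h)
  holds-cong (all' x φ) ρ≗ρ′ h d = holds-cong φ (update-cong ρ≗ρ′ x d) (h d)
  holds-cong (ex' x φ) ρ≗ρ′ (d , h) = d , holds-cong φ (update-cong ρ≗ρ′ x d) h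

update-termStructure : ∀ pr pr′ ρ x d → update (termStructure pr) ρ x d ≗ update (termStructure pr′) ρ x d
update-termStructure pr pr′ ρ x d y with y ≟ x
... | yes _ = refl
... | no _ = refl

transfer : ∀ pr pr′ tr tr′ φ →
  AllLits (λ s P k ts → ∀ ρ → Holds (termStructure pr) ρ (tr s P k ts) →
                              Holds (termStructure pr′) ρ (tr′ s P k ts)) φ →
  ∀ ρ → Holds (termStructure pr) ρ (mapLits tr φ) → Holds (termStructure pr′) ρ (mapLits tr′ φ)
transfer pr pr′ tr tr′ (lit s P k ts) l ρ h = l ρ h
transfer pr pr′ tr tr′ (φ ∧' ψ) (l , l′) ρ (h , h′) =
  transfer pr pr′ tr tr′ φ l ρ h , transfer pr pr′ tr tr′ ψ l′ ρ h′
transfer pr pr′ tr tr′ (φ ∨' ψ) (l , _) ρ (inj₁ h) = inj₁ (transfer pr pr′ tr tr′ φ l ρ h)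
transfer pr pr′ tr tr′ (φ ∨' ψ) (_ , l′) ρ (inj₂ h) = inj₂ (transfer pr pr′ tr tr′ ψ l′ ρ h)
transfer pr pr′ tr tr′ (all' x φ) l ρ h d =
  holds-cong (termStructure pr′) (mapLits tr′ φ) (update-termStructure pr pr′ ρ x d)
    (transfer pr pr′ tr tr′ φ l _ (h d))
transfer pr pr′ tr tr′ (ex' x φ) l ρ (d , h) =
  d , holds-cong (termStructure pr′) (mapLits tr′ φ) (update-termStructure pr pr′ ρ x d)
        (transfer pr pr′ tr tr′ φ l _ h)

-- The image of HTerm in any structure is a substructure, and universal sentences hold in substructures.
module Pullback (M : Structure) where
  open Structure M

  evalWord : D → Word → D
  evalWord d [] = d
  evalWord d (f ∷ w) = evalWord (fun f 1 (d ∷ [])) w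

  ⟦_⟧ : HTerm → D
  ⟦ ⋆ , w ⟧ = evalWord elem w
  ⟦ con c , w ⟧ = evalWord (fun c 0 []) w

  pulledPreds : Preds
  pulledPreds P k ds = pred P k (Vec.map ⟦_⟧ ds)

  private T = termStructure pulledPreds

  evalWord-snoc : ∀ d w f → evalWord d (w ++ [ f ]) ≡ fun f 1 (evalWord d w ∷ [])
  evalWord-snoc d [] f = refl
  evalWord-snoc d (g ∷ w) f = evalWord-snoc (fun g 1 (d ∷ [])) w f

  ⟦⟧-snoc : ∀ a f → ⟦ a · [ f ] ⟧ ≡ fun f 1 (⟦ a ⟧ ∷ [])
  ⟦⟧-snoc (⋆ , w) = evalWord-snoc elem w
  ⟦⟧-snoc (con c , w) = evalWord-snoc (fun c 0 []) w

  ⟦⟧-eval : ∀ ρ t → UnaryTerm t → ⟦ evalT T ρ t ⟧ ≡ evalT M (⟦_⟧ ∘ ρ) t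
  ⟦⟧-eval ρ (var x) _ = refl
  ⟦⟧-eval ρ (app f zero []) _ = refl
  ⟦⟧-eval ρ (app f (suc zero) (t ∷ [])) u =
    trans (⟦⟧-snoc (evalT T ρ t) f) (cong (λ d → fun f 1 (d ∷ [])) (⟦⟧-eval ρ t u))

  ⟦⟧-evals : ∀ ρ {k} (ts : Vec Term k) → UnaryTerms ts → Vec.map ⟦_⟧ (evalTs T ρ ts) ≡ evalTs M (⟦_⟧ ∘ ρ) ts
  ⟦⟧-evals ρ [] _ = refl
  ⟦⟧-evals ρ (t ∷ ts) (u ∷ us) = cong₂ _∷_ (⟦⟧-eval ρ t u) (⟦⟧-evals ρ ts us)

  pull : ∀ φ → AllAtoms (λ _ _ → UnaryTerms) φ → NoExists φ →
    ∀ ρ ρ′ → ⟦_⟧ ∘ ρ ≗ ρ′ → Holds M ρ′ φ → Holds T ρ φ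
  pull (lit true P k ts) us _ ρ ρ′ ρ≗ h =
    subst (pred P k) (sym (trans (⟦⟧-evals ρ ts us) (evals-cong M ρ≗ ts))) h
  pull (lit false P k ts) us _ ρ ρ′ ρ≗ h p =
    h (subst (pred P k) (trans (⟦⟧-evals ρ ts us) (evals-cong M ρ≗ ts)) p)
  pull (φ ∧' ψ) (us , us′) (ne , ne′) ρ ρ′ ρ≗ (h , h′) =
    pull φ us ne ρ ρ′ ρ≗ h , pull ψ us′ ne′ ρ ρ′ ρ≗ h′
  pull (φ ∨' ψ) (us , _) (ne , _) ρ ρ′ ρ≗ (inj₁ h) = inj₁ (pull φ us ne ρ ρ′ ρ≗ h)
  pull (φ ∨' ψ) (_ , us′) (_ , ne′) ρ ρ′ ρ≗ (inj₂ h) = inj₂ (pull ψ us′ ne′ ρ ρ′ ρ≗ h)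
  pull (all' x φ) us ne ρ ρ′ ρ≗ h d = pull φ us ne (update T ρ x d) (update M ρ′ x ⟦ d ⟧) ρ≗′ (h ⟦ d ⟧)
    where
    ρ≗′ : ⟦_⟧ ∘ update T ρ x d ≗ update M ρ′ x ⟦ d ⟧
    ρ≗′ y with y ≟ x
    ... | yes _ = refl
    ... | no _ = ρ≗ y

module _ (M : Structure) {ρ : ℕ → Structure.D M} (c : HTerm → Formula) (base : Formula) where

  bigAnd-intro : ∀ gs → (∀ {g} → g ∈ gs → Holds M ρ (c g)) → Holds M ρ base → Holds M ρ (bigAnd c base gs)
  bigAnd-intro [] _ h = h
  bigAnd-intro (g ∷ gs) hs h = hs (here refl) , bigAnd-intro gs (hs ∘ there) h

  bigAnd-base : ∀ gs → Holds M ρ (bigAnd c base gs) → Holds M ρ base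
  bigAnd-base [] h = h
  bigAnd-base (g ∷ gs) (_ , h) = bigAnd-base gs h

  bigAnd-elem : ∀ {gs g} → Holds M ρ (bigAnd c base gs) → g ∈ gs → Holds M ρ (c g)
  bigAnd-elem (h , _) (here refl) = h
  bigAnd-elem (_ , h) (there g∈gs) = bigAnd-elem h g∈gs


Signed : Bool → Set → Set
Signed true X = X
Signed false X = ¬ X

signed-map : ∀ s {X Y : Set} → (X → Y) → (Y → X) → Signed s X → Signed s Y
signed-map true f g x = f x
signed-map false f g ¬x y = ¬x (g y)

module _ (M : Structure) {ρ : ℕ → Structure.D M} where
  open Structure M

  holds⇒signed : ∀ s {P k} ts → Holds M ρ (lit s P k ts) → Signed s (pred P k (evalTs M ρ ts))
  holds⇒signed true ts h = h
  holds⇒signed false ts h = h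

  signed⇒holds : ∀ s {P k} ts → Signed s (pred P k (evalTs M ρ ts)) → Holds M ρ (lit s P k ts)
  signed⇒holds true ts h = h
  signed⇒holds false ts h = h

toList-injective : ∀ {A : Set} {k} (u v : Vec A k) → toList u ≡ toList v → u ≡ v
toList-injective u v eq = trans (sym (VecP.cast-is-id refl u)) (VecP.toList-injective refl u v eq)

decodePred : ℕ → ℕ ⊎ ℕ
decodePred zero = inj₁ 0
decodePred (suc zero) = inj₂ 0
decodePred (suc (suc n)) = Sum.map suc suc (decodePred n)

decode-patternPred : ∀ i → decodePred (patternPred i) ≡ inj₁ i
decode-patternPred zero = refl
decode-patternPred (suc i) rewrite +-suc i i | decode-patternPred i = refl

decode-specialPred : ∀ j → decodePred (specialPred j) ≡ inj₂ j
decode-specialPred zero = refl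
decode-specialPred (suc j) rewrite +-suc j j | decode-specialPred j = refl

SingleVar : ∀ {k} → Vec Term k → Set
SingleVar ts = ∀ x r → varsTs ts ≡ x ∷ r → All (_≡ x) (varsTs ts)

LitFacts : List Template → (P k : ℕ) → Vec Term k → Set
LitFacts G P k ts = UnaryTerms ts × SingleVar ts × templateOf P k ts ∈ G

patternOf-con : ∀ {k} (ts : Vec Term k) → ConGround (patternOf ts)
patternOf-con ts = reduct-preserves (λ _ → tt) (rawPattern ts) (rawPattern-con ts)

instantiate-ground-con : ∀ {p} a → Ground p → ConGround p → All IsCon (instantiate a p)
instantiate-ground-con a [] [] = []
instantiate-ground-con {gnd _ ∷ _} a (_ ∷ g) (c ∷ cs) = c ∷ instantiate-ground-con a g cs

lookup-template : ∀ {G} P k (ts : Vec Term k) → templateOf P k ts ∈ G →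
  lookup? G (indexOf template≟ G (templateOf P k ts)) ≡ just (P , k , patternOf ts)
lookup-template P k ts = lookup-indexOf template≟

instantiate-⌜⌝ : ∀ pr ρ a p → All IsCon (instantiate a p) →
  instantiate (evalT (termStructure pr) ρ ⌜ a ⌝) p ≡ instantiate a p
instantiate-⌜⌝ pr ρ a p cons with hasVar? p
... | inj₁ v = cong (λ b → instantiate b p) (eval-⌜⌝-con pr ρ a (con-instantiate v cons))
... | inj₂ g = ground-instantiate _ a g

-- From a model over HTerm to a model of the translation

module Forward (pr : Preds) (G : List Template) (S : List HTerm) (S-con : All IsCon S) where

  InstanceHolds : Template → HTerm → Set
  InstanceHolds (P , k , p) d = Σ (Vec HTerm k) λ v → toList v ≡ instantiate d p × pr P k v

  UnaryPred : ℕ ⊎ ℕ → HTerm → Set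
  UnaryPred (inj₁ i) d = Σ Template λ e → lookup? G i ≡ just e × InstanceHolds e d
  UnaryPred (inj₂ j) d = lookup? S j ≡ just d

  unaryPreds : Preds
  unaryPreds n (suc zero) (d ∷ []) = UnaryPred (decodePred n) d
  unaryPreds _ _ _ = ⊥

  T = termStructure pr
  U = termStructure unaryPreds
  open Translation G S

  patternPred⇔ : ∀ {i P k p d} (v : Vec HTerm k) → lookup? G i ≡ just (P , k , p) → toList v ≡ instantiate d p →
    ∀ s → Signed s (pr P k v) → Signed s (unaryPreds (patternPred i) 1 (d ∷ []))
  patternPred⇔ {i} v lk eq s rewrite decode-patternPred i = signed-map s (λ h → _ , lk , v , eq , h) from
    where
    from : UnaryPred (inj₁ i) _ → pr _ _ v
    from (_ , lk′ , v′ , eq′ , h) with refl ← trans (sym lk) lk′ =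
      subst (pr _ _) (toList-injective v′ v (trans eq′ (sym eq))) h

  specialPred⇔ : ∀ {j g} d → lookup? S j ≡ just g → (d ≡ g) ⇔ unaryPreds (specialPred j) 1 (d ∷ [])
  specialPred⇔ {j} d lk rewrite decode-specialPred j =
    mk⇔ (λ { refl → lk }) (λ lk′ → just-injective (trans (sym lk′) lk))

  canonical-forward : ∀ s P k τ (v : Vec HTerm k) ρ n p₀ {a₀} → All IsCon τ →
    lookup? G n ≡ just (P , k , p₀) → match p₀ τ ≡ just a₀ → toList v ≡ τ →
    Signed s (pr P k v) → Holds U ρ (canonicalLit G s P k τ)
  canonical-forward s P k τ v ρ n p₀ cons lk m v≡τ h
    with (i , a) , fm ← firstMatch-complete G P k τ n p₀ lk m rewrite fm
    with p , lk′ , m′ ← firstMatch-sound G P k τ fm = λ d →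
      let a·p≡τ = proj₂ (match-sound p τ m′)
          ⟦a⟧·p≡τ = trans (instantiate-⌜⌝ unaryPreds _ a p (subst (All IsCon) (sym a·p≡τ) cons)) a·p≡τ
      in signed⇒holds U s (⌜ a ⌝ ∷ []) (patternPred⇔ v lk′ (trans v≡τ (sym ⟦a⟧·p≡τ)) s h)

  translateLit-forward : ∀ s P k ts → LitFacts G P k ts →
    ∀ ρ → Holds T ρ (lit s P k ts) → Holds U ρ (translateLit s P k ts)
  translateLit-forward s P k ts (us , single , t∈G) ρ h with varsTs ts in eq
  ... | [] = canonical-forward s P k _ (evalTs T ρ ts) ρ _ (patternOf ts)
               (instantiate-ground-con (⋆ , []) p-ground (patternOf-con ts)) (lookup-template P k ts t∈G)
               (match-candidate-instance (patternOf ts) (⋆ , [])) (eval-args-ground pr ρ ts us eq)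
               (holds⇒signed T s ts h)
    where
    p-ground : Ground (patternOf ts)
    p-ground = subst Ground (sym (patternOf-ground us eq)) (rawPattern-ground us eq)
  ... | x ∷ r = bigAnd-intro U _ _ S guard main
    where
    p = patternOf ts
    xu = applyWord (var x) (prefixOf ts)
    d = evalT U ρ xu
    args : toList (evalTs T ρ ts) ≡ instantiate d p
    args = trans (eval-args-prefix pr ρ x ts us (subst (All (_≡ x)) (sym eq) (single x r refl)))
                 (cong (λ a → instantiate a p) (trans (eval-applyWord pr ρ (var x) (prefixOf ts))
                                                      (sym (eval-applyWord unaryPreds ρ (var x) (prefixOf ts)))))
    signed = holds⇒signed T s ts h
    main : Holds U ρ (lit s (patternPred (indexOf template≟ G (templateOf P k ts))) 1 (xu ∷ []))
    main = signed⇒holds U s (xu ∷ []) (patternPred⇔ _ (lookup-template P k ts t∈G) args s signed)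
    guard : ∀ {g} → g ∈ S → Holds U ρ (guarded s P k p xu g)
    guard {g} g∈S with hterm≟ d g
    ... | yes refl = inj₂ (canonical-forward s P k (instantiate d p) _ ρ _ p
                             (instantiate-con (All.lookup S-con g∈S) (patternOf-con ts)) (lookup-template P k ts t∈G)
                             (match-candidate-instance p d) args signed)
    ... | no d≢g = inj₁ (λ special → d≢g (Equivalence.from (specialPred⇔ d (lookup-indexOf hterm≟ g∈S)) special))

-- From a model of the translation back to a model over HTerm

WellFormed : Pattern → Set
WellFormed p = (HasVar p → Reduced p) × ConGround p

patternOf-wellFormed : ∀ {k} (ts : Vec Term k) → WellFormed (patternOf ts)
patternOf-wellFormed ts with hasVar? (rawPattern ts)
... | inj₁ v = (λ _ → reduct-reduced (rawPattern ts) v) , patternOf-con ts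
... | inj₂ g = (λ v → ⊥-elim (¬hasVar-ground v (subst Ground (sym reduct≡) g))) , patternOf-con ts
  where reduct≡ = reduct-ground (rawPattern ts) g

templates-wellFormed : ∀ φ → All (WellFormed ∘ pattern-of) (templates φ)
templates-wellFormed (lit _ P k ts) = patternOf-wellFormed ts ∷ []
templates-wellFormed (φ ∧' ψ) = AllP.++⁺ (templates-wellFormed φ) (templates-wellFormed ψ)
templates-wellFormed (φ ∨' ψ) = AllP.++⁺ (templates-wellFormed φ) (templates-wellFormed ψ)
templates-wellFormed (all' _ φ) = templates-wellFormed φ
templates-wellFormed (ex' _ φ) = templates-wellFormed φ

specials-con : ∀ G → All IsCon (specials G)
specials-con G = AllP.all-filter isCon? (concatMap (clashesWith G) G)

∈-specials : ∀ G {e e′ d} → e ∈ G → e′ ∈ G → IsCon d → d ∈ clashCandidates (pattern-of e) (pattern-of e′) →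
  d ∈ specials G
∈-specials G {e} e∈G e′∈G d-con d∈ =
  ∈-filter⁺ isCon? (∈-concatMap⁺ (clashesWith G) (lose e∈G (∈-concatMap⁺ clashesWith-e (lose e′∈G d∈)))) d-con
  where clashesWith-e = λ e′ → clashCandidates (pattern-of e) (pattern-of e′)

module Backward (pr : Preds) (G : List Template) (G-wf : All (WellFormed ∘ pattern-of) G) where

  S = specials G
  open Translation G S

  CanonicalHolds : Maybe (ℕ × HTerm) → Set
  CanonicalHolds (just (i , a)) = pr (patternPred i) 1 (a ∷ [])
  CanonicalHolds nothing = ⊥

  decodedPreds : Preds
  decodedPreds P k ds = CanonicalHolds (firstMatch G P k (toList ds))

  T = termStructure pr
  D = termStructure decodedPreds

  canonical-backward : ∀ s P k τ (v : Vec HTerm k) ρ {r} → firstMatch G P k τ ≡ just r → toList v ≡ τ →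
    Holds T ρ (canonicalLit G s P k τ) → Signed s (decodedPreds P k v)
  canonical-backward s P k τ v ρ {i , a} fm refl h rewrite fm =
    subst (λ b → Signed s (pr (patternPred i) 1 (b ∷ [])))
      (eval-⌜⌝-⋆ pr (update T ρ 0 (⋆ , [])) a refl) (holds⇒signed T s (⌜ a ⌝ ∷ []) (h (⋆ , [])))

  unique-match : ∀ P k p d → (P , k , p) ∈ G → HasVar p → WellFormed p → d ∉ S →
    firstMatch G P k (instantiate d p) ≡ just (indexOf template≟ G (P , k , p) , d)
  unique-match P k p d e∈G v (red , p-con) d∉S =
    firstMatch-unique G P k _ p e∈G (match-instantiate p d v) others
    where
    others : ∀ e → e ∈ G → e ≢ (P , k , p) → ∀ a → matchTemplate e P k (instantiate d p) ≢ just a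
    others (P′ , k′ , p′) e′∈G e≢ a m with refl , refl , m′ ← matchTemplate-sound P′ k′ p′ P k _ m =
      let red′ , con′ = All.lookup G-wf e′∈G
          d-con , d∈ = distinct-patterns-clash p p′ a d (proj₂ (match-sound p′ _ m′)) v (red v) red′ p-con con′
                         (λ p′≡p → e≢ (cong (λ q → P , k , q) p′≡p))
      in d∉S (∈-specials G e∈G e′∈G d-con d∈)

  module _ (axioms : ∀ {g} → g ∈ S → pr (specialPred (indexOf hterm≟ S g)) 1 (g ∷ [])) where

    translateLit-backward : ∀ s P k ts → LitFacts G P k ts →
      ∀ ρ → Holds T ρ (translateLit s P k ts) → Holds D ρ (lit s P k ts)
    translateLit-backward s P k ts (us , single , t∈G) ρ h with varsTs ts in eq
    ... | [] = signed⇒holds D s ts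
                 (canonical-backward s P k _ (evalTs D ρ ts) ρ fm (eval-args-ground decodedPreds ρ ts us eq) h)
      where
      fm = proj₂ (firstMatch-complete G P k _ _ (patternOf ts) (lookup-template P k ts t∈G)
                    (match-candidate-instance (patternOf ts) (⋆ , [])))
    ... | x ∷ r = signed⇒holds D s ts (special-or-not (DecMembership._∈?_ hterm≟ d S))
      where
      p = patternOf ts
      xu = applyWord (var x) (prefixOf ts)
      d = evalT T ρ xu
      mainLit = lit s (patternPred (indexOf template≟ G (templateOf P k ts))) 1 (xu ∷ [])
      p-var : HasVar p
      p-var = patternOf-hasVar us eq
      args : toList (evalTs D ρ ts) ≡ instantiate d p
      args = trans (eval-args-prefix decodedPreds ρ x ts us (subst (All (_≡ x)) (sym eq) (single x r refl)))
                   (cong (λ a → instantiate a p) (trans (eval-applyWord decodedPreds ρ (var x) (prefixOf ts))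
                                                        (sym (eval-applyWord pr ρ (var x) (prefixOf ts)))))
      special-or-not : Dec (d ∈ S) → Signed s (decodedPreds P k (evalTs D ρ ts))
      special-or-not (yes d∈S) with bigAnd-elem T (guarded s P k p xu) mainLit h d∈S
      ... | inj₁ ¬special = ⊥-elim (¬special (axioms d∈S))
      ... | inj₂ canon = canonical-backward s P k _ _ ρ fm args canon
        where
        fm = proj₂ (firstMatch-complete G P k _ _ p (lookup-template P k ts t∈G) (match-instantiate p d p-var))
      special-or-not (no d∉S)
        rewrite args | unique-match P k p d t∈G p-var (patternOf-wellFormed ts) d∉S =
        holds⇒signed T s (xu ∷ []) (bigAnd-base T (guarded s P k p xu) mainLit S h)

unaryTerm : ∀ t → (∀ f k → FunOccT f k t → k ≤ 1) → UnaryTerm t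
unaryTerm (var x) _ = tt
unaryTerm (app f zero ts) _ = tt
unaryTerm (app f (suc zero) (t ∷ [])) ar = unaryTerm t λ g k o → ar g k (inj₂ (inj₁ o))
unaryTerm (app f (suc (suc k)) ts) ar with s≤s () ← ar f (suc (suc k)) (inj₁ (refl , refl))

unaryTerms : ∀ {k} (ts : Vec Term k) → (∀ f j → FunOccTs f j ts → j ≤ 1) → UnaryTerms ts
unaryTerms [] _ = []
unaryTerms (t ∷ ts) ar = unaryTerm t (λ f j o → ar f j (inj₁ o)) ∷ unaryTerms ts (λ f j o → ar f j (inj₂ o))

unaryAtoms : ∀ φ → FunArityAtMostOne φ → AllAtoms (λ _ _ → UnaryTerms) φ
unaryAtoms (lit _ _ _ ts) ar = unaryTerms ts ar
unaryAtoms (φ ∧' ψ) ar = unaryAtoms φ (λ f k o → ar f k (inj₁ o)) , unaryAtoms ψ (λ f k o → ar f k (inj₂ o))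
unaryAtoms (φ ∨' ψ) ar = unaryAtoms φ (λ f k o → ar f k (inj₁ o)) , unaryAtoms ψ (λ f k o → ar f k (inj₂ o))
unaryAtoms (all' _ φ) ar = unaryAtoms φ ar
unaryAtoms (ex' _ φ) ar = unaryAtoms φ ar

singleVarAtoms : ∀ φ → AtMostOneVar φ → AllAtoms (λ _ _ → SingleVar) φ
singleVarAtoms (lit _ _ _ ts) (y , all≡y) x r e with x≡y ∷ _ ← subst (All (_≡ y)) e all≡y =
  subst (λ z → All (_≡ z) (varsTs ts)) (sym x≡y) all≡y
singleVarAtoms (φ ∧' ψ) (a , b) = singleVarAtoms φ a , singleVarAtoms ψ b
singleVarAtoms (φ ∨' ψ) (a , b) = singleVarAtoms φ a , singleVarAtoms ψ b
singleVarAtoms (all' _ φ) a = singleVarAtoms φ a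
singleVarAtoms (ex' _ φ) a = singleVarAtoms φ a

templates-⊆ : ∀ φ {G} → (∀ {e} → e ∈ templates φ → e ∈ G) → AllAtoms (λ P k ts → templateOf P k ts ∈ G) φ
templates-⊆ (lit _ _ _ _) ⊆G = ⊆G (here refl)
templates-⊆ (φ ∧' ψ) ⊆G = templates-⊆ φ (⊆G ∘ ∈-++⁺ˡ) , templates-⊆ ψ (⊆G ∘ ∈-++⁺ʳ (templates φ))
templates-⊆ (φ ∨' ψ) ⊆G = templates-⊆ φ (⊆G ∘ ∈-++⁺ˡ) , templates-⊆ ψ (⊆G ∘ ∈-++⁺ʳ (templates φ))
templates-⊆ (all' _ φ) ⊆G = templates-⊆ φ ⊆G
templates-⊆ (ex' _ φ) ⊆G = templates-⊆ φ ⊆G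

litFacts : ∀ φ → InFragment φ → AllAtoms (LitFacts (templates φ)) φ
litFacts φ (ar , _ , one) =
  AllAtoms-zip φ (unaryAtoms φ ar) (AllAtoms-zip φ (singleVarAtoms φ one) (templates-⊆ φ (λ e∈ → e∈)))

module _ {Q : (P k : ℕ) → Vec Term k → Set} where

  bigAnd-atoms : ∀ c base gs → (∀ {g} → g ∈ gs → AllAtoms Q (c g)) → AllAtoms Q base → AllAtoms Q (bigAnd c base gs)
  bigAnd-atoms c base [] _ q = q
  bigAnd-atoms c base (g ∷ gs) qs q = qs (here refl) , bigAnd-atoms c base gs (qs ∘ there) q

  mapLits-atoms : ∀ tr φ → AllLits (λ s P k ts → AllAtoms Q (tr s P k ts)) φ → AllAtoms Q (mapLits tr φ)
  mapLits-atoms tr (lit s P k ts) q = q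
  mapLits-atoms tr (φ ∧' ψ) (q , q′) = mapLits-atoms tr φ q , mapLits-atoms tr ψ q′
  mapLits-atoms tr (φ ∨' ψ) (q , q′) = mapLits-atoms tr φ q , mapLits-atoms tr ψ q′
  mapLits-atoms tr (all' _ φ) q = mapLits-atoms tr φ q
  mapLits-atoms tr (ex' _ φ) q = mapLits-atoms tr φ q

  canonicalLit-atoms : ∀ G s P k τ → (∀ {i a} → firstMatch G P k τ ≡ just (i , a) → Q (patternPred i) 1 (⌜ a ⌝ ∷ [])) →
    Q 0 1 (var 0 ∷ []) → AllAtoms Q (canonicalLit G s P k τ)
  canonicalLit-atoms G s P k τ q⌜⌝ q₀ with firstMatch G P k τ
  ... | just (_ , _) = q⌜⌝ refl
  ... | nothing = q₀

  translateLit-atoms : ∀ G S s P k (ts : Vec Term k) →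
    (∀ {b i a} → b ≡ (⋆ , []) ⊎ b ∈ S → firstMatch G P k (instantiate b (patternOf ts)) ≡ just (i , a) →
       Q (patternPred i) 1 (⌜ a ⌝ ∷ [])) →
    Q 0 1 (var 0 ∷ []) →
    (∀ {x r} → varsTs ts ≡ x ∷ r → ∀ n → Q n 1 (applyWord (var x) (prefixOf ts) ∷ [])) →
    AllAtoms Q (Translation.translateLit G S s P k ts)
  translateLit-atoms G S s P k ts q⌜⌝ q₀ qx with varsTs ts
  ... | [] = canonicalLit-atoms G s P k _ (q⌜⌝ (inj₁ refl)) q₀
  ... | x ∷ r = bigAnd-atoms _ _ S
                  (λ g∈S → qx refl _ , canonicalLit-atoms G s P k _ (q⌜⌝ (inj₂ g∈S)) q₀)
                  (qx refl _)

  translate-atoms : ∀ φ → (∀ {g} → g ∈ specials (templates φ) → ∀ n → Q n 1 (⌜ g ⌝ ∷ [])) →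
    AllLits (λ s P k ts → AllAtoms Q (Translation.translateLit (templates φ) (specials (templates φ)) s P k ts)) φ →
    AllAtoms Q (translate φ)
  translate-atoms φ q-axiom q-lits =
    bigAnd-atoms _ _ (specials (templates φ)) (λ g∈S → q-axiom g∈S _) (mapLits-atoms _ φ q-lits)

translate-unaryPreds : ∀ φ → AllPredsUnary (translate φ)
translate-unaryPreds φ = translate-atoms φ (λ _ _ → refl)
  (allLits (λ s P k ts → translateLit-atoms _ _ s P k ts (λ _ _ → refl) refl (λ _ _ → refl)) φ)

applyWord-unary : ∀ t w → UnaryTerm t → UnaryTerm (applyWord t w)
applyWord-unary t [] u = u
applyWord-unary t (f ∷ w) u = applyWord-unary (app f 1 (t ∷ [])) w u

⌜⌝-unary : ∀ a → UnaryTerm ⌜ a ⌝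
⌜⌝-unary (⋆ , w) = applyWord-unary (var 0) w tt
⌜⌝-unary (con c , w) = applyWord-unary (app c 0 []) w tt

translate-unaryTerms : ∀ φ → AllAtoms (λ _ _ → UnaryTerms) (translate φ)
translate-unaryTerms φ = translate-atoms φ (λ {g} _ _ → ⌜⌝-unary g ∷ [])
  (allLits (λ s P k ts → translateLit-atoms _ _ s P k ts (λ {_ _ a} _ _ → ⌜⌝-unary a ∷ []) (tt ∷ [])
                           (λ {x} _ _ → applyWord-unary (var x) (prefixOf ts) tt ∷ [])) φ)

bigAnd-noExists : ∀ c base gs → (∀ g → NoExists (c g)) → NoExists base → NoExists (bigAnd c base gs)
bigAnd-noExists c base [] _ ne = ne
bigAnd-noExists c base (g ∷ gs) nes ne = nes g , bigAnd-noExists c base gs nes ne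

canonicalLit-noExists : ∀ G s P k τ → NoExists (canonicalLit G s P k τ)
canonicalLit-noExists G s P k τ with firstMatch G P k τ
... | just _ = tt
... | nothing = tt

translate-noExists : ∀ φ → NoExists φ → NoExists (translate φ)
translate-noExists φ ne = bigAnd-noExists _ _ S (λ _ → tt) (mapLits-noExists φ ne)
  where
  S = specials (templates φ)
  open Translation (templates φ) S

  translateLit-noExists : ∀ s P k ts → NoExists (translateLit s P k ts)
  translateLit-noExists s P k ts with varsTs ts
  ... | [] = canonicalLit-noExists (templates φ) s P k _
  ... | _ ∷ _ = bigAnd-noExists _ _ S (λ g → tt , canonicalLit-noExists (templates φ) s P k (instantiate g (patternOf ts))) tt

  mapLits-noExists : ∀ φ → NoExists φ → NoExists (mapLits translateLit φ)
  mapLits-noExists (lit s P k ts) _ = translateLit-noExists s P k ts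
  mapLits-noExists (φ ∧' ψ) (ne , ne′) = mapLits-noExists φ ne , mapLits-noExists ψ ne′
  mapLits-noExists (φ ∨' ψ) (ne , ne′) = mapLits-noExists φ ne , mapLits-noExists ψ ne′
  mapLits-noExists (all' _ φ) ne = mapLits-noExists φ ne

vars-applyWord : ∀ t w → varsT (applyWord t w) ≡ varsT t
vars-applyWord t [] = refl
vars-applyWord t (f ∷ w) = trans (vars-applyWord (app f 1 (t ∷ [])) w) (++-identityʳ (varsT t))

vars-⌜⌝ : ∀ a → All (_≡ 0) (varsT ⌜ a ⌝)
vars-⌜⌝ (⋆ , w) rewrite vars-applyWord (var 0) w = refl ∷ []
vars-⌜⌝ (con c , w) rewrite vars-applyWord (app c 0 []) w = []

vars-⌜⌝-con : ∀ a → IsCon a → varsT ⌜ a ⌝ ≡ []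
vars-⌜⌝-con (con c , w) _ = vars-applyWord (app c 0 []) w

bigAnd-closed : ∀ bs c base gs → (∀ {g} → g ∈ gs → ClosedUnder bs (c g)) → ClosedUnder bs base →
  ClosedUnder bs (bigAnd c base gs)
bigAnd-closed bs c base [] _ cl = cl
bigAnd-closed bs c base (g ∷ gs) cls cl = cls (here refl) , bigAnd-closed bs c base gs (cls ∘ there) cl

canonicalLit-closed : ∀ bs G s P k τ → ClosedUnder bs (canonicalLit G s P k τ)
canonicalLit-closed bs G s P k τ with firstMatch G P k τ
... | just (_ , a) = AllP.++⁺ (All.map (λ { refl → here refl }) (vars-⌜⌝ a)) []
... | nothing = here refl ∷ []

translate-sentence : ∀ φ → Sentence φ → Sentence (translate φ)
translate-sentence φ closed =
  bigAnd-closed [] _ _ S axiom-closed (mapLits-closed φ [] closed)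
  where
  G = templates φ
  S = specials G
  open Translation G S

  axiom-closed : ∀ {g} → g ∈ S → ClosedUnder [] (axiom g)
  axiom-closed {g} g∈S rewrite vars-⌜⌝-con g (All.lookup (specials-con G) g∈S) = []

  translateLit-closed : ∀ bs s P k ts → All (_∈ bs) (varsTs ts) → ClosedUnder bs (translateLit s P k ts)
  translateLit-closed bs s P k ts vs with varsTs ts
  ... | [] = canonicalLit-closed bs G s P k _
  ... | x ∷ _ with x∈bs ∷ _ ← vs = bigAnd-closed bs _ _ S (λ _ → xu-closed , canonicalLit-closed bs G s P k _) xu-closed
    where
    xu-closed : All (_∈ bs) (varsT (applyWord (var x) (prefixOf ts)) ++ [])
    xu-closed rewrite vars-applyWord (var x) (prefixOf ts) = x∈bs ∷ []

  mapLits-closed : ∀ φ bs → ClosedUnder bs φ → ClosedUnder bs (mapLits translateLit φ)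
  mapLits-closed (lit s P k ts) bs cl = translateLit-closed bs s P k ts cl
  mapLits-closed (φ ∧' ψ) bs (cl , cl′) = mapLits-closed φ bs cl , mapLits-closed ψ bs cl′
  mapLits-closed (φ ∨' ψ) bs (cl , cl′) = mapLits-closed φ bs cl , mapLits-closed ψ bs cl′
  mapLits-closed (all' x φ) bs cl = mapLits-closed φ (x ∷ bs) cl
  mapLits-closed (ex' x φ) bs cl = mapLits-closed φ (x ∷ bs) cl

translate-equisatisfiable : ∀ φ → InFragment φ → Equisatisfiable φ (translate φ)
translate-equisatisfiable φ frag@(ar , ne , _) = mk⇔ forward backward
  where
  G = templates φ
  S = specials G
  open Translation G S

  forward : Satisfiable φ → Satisfiable (translate φ)
  forward (M , M⊨φ) = F.U , bigAnd-intro F.U axiom _ S axioms-hold lits-hold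
    where
    open Pullback M
    module F = Forward pulledPreds G S (specials-con G)
    T⊨φ : Holds F.T ρ⋆ (mapLits lit φ)
    T⊨φ = subst (Holds F.T ρ⋆) (sym (mapLits-lit φ))
            (pull φ (unaryAtoms φ ar) ne ρ⋆ (λ _ → Structure.elem M) (λ _ → refl) M⊨φ)
    lits-hold : Holds F.U ρ⋆ (mapLits translateLit φ)
    lits-hold = transfer pulledPreds F.unaryPreds lit translateLit φ
      (AllAtoms⇒AllLits (λ {s P k ts} → F.translateLit-forward s P k ts) φ (litFacts φ frag)) ρ⋆ T⊨φ
    axioms-hold : ∀ {g} → g ∈ S → Holds F.U ρ⋆ (axiom g)
    axioms-hold {g} g∈S = Equivalence.to (F.specialPred⇔ _ (lookup-indexOf hterm≟ g∈S))
      (eval-⌜⌝-con F.unaryPreds ρ⋆ g (All.lookup (specials-con G) g∈S))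

  backward : Satisfiable (translate φ) → Satisfiable φ
  backward (M , M⊨φ′) = B.D , subst (Holds B.D ρ⋆) (mapLits-lit φ) lits-hold
    where
    open Pullback M
    module B = Backward pulledPreds G (templates-wellFormed φ)
    T⊨φ′ : Holds B.T ρ⋆ (translate φ)
    T⊨φ′ = pull (translate φ) (translate-unaryTerms φ) (translate-noExists φ ne) ρ⋆ (λ _ → Structure.elem M)
             (λ _ → refl) M⊨φ′
    axioms : ∀ {g} → g ∈ S → pulledPreds (specialPred (indexOf hterm≟ S g)) 1 (g ∷ [])
    axioms {g} g∈S =
      subst (λ b → pulledPreds _ 1 (b ∷ [])) (eval-⌜⌝-con pulledPreds ρ⋆ g (All.lookup (specials-con G) g∈S))
      (bigAnd-elem B.T axiom (mapLits translateLit φ) T⊨φ′ g∈S)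
    lits-hold : Holds B.D ρ⋆ (mapLits lit φ)
    lits-hold = transfer pulledPreds B.decodedPreds translateLit lit φ
      (AllAtoms⇒AllLits (λ {s P k ts} → B.translateLit-backward axioms s P k ts) φ (litFacts φ frag)) ρ⋆
      (bigAnd-base B.T axiom (mapLits translateLit φ) S T⊨φ′)

FunOccs : (ℕ → ℕ → Set) → ∀ {k} → Vec Term k → Set
FunOccs Occ ts = ∀ f j → FunOccTs f j ts → Occ f j

atoms-funOcc : ∀ {Occ : ℕ → ℕ → Set} φ → AllAtoms (λ _ _ → FunOccs Occ) φ → ∀ f j → FunOcc f j φ → Occ f j
atoms-funOcc (lit _ _ _ _) occ = occ
atoms-funOcc (φ ∧' ψ) (occ , _) f j (inj₁ o) = atoms-funOcc φ occ f j o
atoms-funOcc (φ ∧' ψ) (_ , occ) f j (inj₂ o) = atoms-funOcc ψ occ f j o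
atoms-funOcc (φ ∨' ψ) (occ , _) f j (inj₁ o) = atoms-funOcc φ occ f j o
atoms-funOcc (φ ∨' ψ) (_ , occ) f j (inj₂ o) = atoms-funOcc ψ occ f j o
atoms-funOcc (all' _ φ) occ = atoms-funOcc φ occ
atoms-funOcc (ex' _ φ) occ = atoms-funOcc φ occ

funOcc-atoms : ∀ φ → AllAtoms (λ _ _ → FunOccs (λ f j → FunOcc f j φ)) φ
funOcc-atoms φ = go φ (λ _ _ o → o)
  where
  go : ∀ ψ {Occ : ℕ → ℕ → Set} → (∀ f j → FunOcc f j ψ → Occ f j) → AllAtoms (λ _ _ → FunOccs Occ) ψ
  go (lit _ _ _ _) occ = occ
  go (ψ ∧' χ) occ = go ψ (λ f j o → occ f j (inj₁ o)) , go χ (λ f j o → occ f j (inj₂ o))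
  go (ψ ∨' χ) occ = go ψ (λ f j o → occ f j (inj₁ o)) , go χ (λ f j o → occ f j (inj₂ o))
  go (all' _ ψ) occ = go ψ occ
  go (ex' _ ψ) occ = go ψ occ

funOcc-applyWord : ∀ f k t w → FunOccT f k (applyWord t w) → FunOccT f k t ⊎ (k ≡ 1 × f ∈ w)
funOcc-applyWord f k t [] o = inj₁ o
funOcc-applyWord f k t (g ∷ w) o with funOcc-applyWord f k (app g 1 (t ∷ [])) w o
... | inj₁ (inj₁ (refl , refl)) = inj₂ (refl , here refl)
... | inj₁ (inj₂ (inj₁ o′)) = inj₁ o′
... | inj₂ (k≡1 , f∈w) = inj₂ (k≡1 , there f∈w)

module Symbols (Occ : ℕ → ℕ → Set) where

  WordOcc : Word → Set
  WordOcc = All (λ f → Occ f 1)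

  HeadOcc : Head → Set
  HeadOcc ⋆ = ⊤
  HeadOcc (con c) = Occ c 0

  HTermOcc : HTerm → Set
  HTermOcc (h , w) = HeadOcc h × WordOcc w

  PatternOcc : Pattern → Set
  PatternOcc = All (ArgAll WordOcc HTermOcc)

  dropSuffix-occ : ∀ n {a} → HTermOcc a → HTermOcc (dropSuffix n a)
  dropSuffix-occ n {_ , w} (h , ws) = h , AllP.take⁺ (length w ∸ n) ws

  instantiate-occ : ∀ {a p} → HTermOcc a → PatternOcc p → All HTermOcc (instantiate a p)
  instantiate-occ a-occ [] = []
  instantiate-occ {a = _ , _} {var· _ ∷ _} (h , ws) (ws′ ∷ occ) = (h , AllP.++⁺ ws ws′) ∷ instantiate-occ (h , ws) occ
  instantiate-occ {p = gnd _ ∷ _} a-occ (g ∷ occ) = g ∷ instantiate-occ a-occ occ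

  candidate-occ : ∀ p {τ} → All HTermOcc τ → HTermOcc (candidate p τ)
  candidate-occ (var· w ∷ _) {t ∷ _} (t-occ ∷ _) = dropSuffix-occ (length w) {t} t-occ
  candidate-occ (gnd _ ∷ p) (_ ∷ τ) = candidate-occ p τ
  candidate-occ [] _ = tt , []
  candidate-occ (var· _ ∷ _) [] = tt , []
  candidate-occ (gnd _ ∷ _) [] = tt , []

  match-occ : ∀ p {τ a} → All HTermOcc τ → match p τ ≡ just a → HTermOcc a
  match-occ p τ-occ m with refl , _ ← match-sound p _ m = candidate-occ p τ-occ

  firstMatch-occ : ∀ G P k {τ i a} → All HTermOcc τ → firstMatch G P k τ ≡ just (i , a) → HTermOcc a
  firstMatch-occ G P k τ-occ fm with p , _ , m ← firstMatch-sound G P k _ fm = match-occ p τ-occ m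

  ⌜⌝-occ : ∀ a → HTermOcc a → FunOccs Occ (⌜ a ⌝ ∷ [])
  ⌜⌝-occ (⋆ , w) (_ , ws) f j (inj₁ o) with funOcc-applyWord f j (var 0) w o
  ... | inj₂ (refl , f∈w) = All.lookup ws f∈w
  ⌜⌝-occ (con c , w) (c-occ , ws) f j (inj₁ o) with funOcc-applyWord f j (app c 0 []) w o
  ... | inj₁ (inj₁ (refl , refl)) = c-occ
  ... | inj₂ (refl , f∈w) = All.lookup ws f∈w

  applyWord-var-occ : ∀ x w → WordOcc w → FunOccs Occ (applyWord (var x) w ∷ [])
  applyWord-var-occ x w ws f j (inj₁ o) with funOcc-applyWord f j (var x) w o
  ... | inj₂ (refl , f∈w) = All.lookup ws f∈w

  firstWord-occ : ∀ {p} → PatternOcc p → WordOcc (firstWord p)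
  firstWord-occ [] = []
  firstWord-occ {var· _ ∷ _} (ws ∷ _) = ws
  firstWord-occ {gnd _ ∷ _} (_ ∷ occ) = firstWord-occ occ

  prefix-occ : ∀ p → PatternOcc p → WordOcc (prefix p)
  prefix-occ p occ = let v , e = prefix-firstWord p in
    AllP.++⁻ˡ (prefix p) (subst WordOcc e (firstWord-occ occ))

  reduct-occ : ∀ p → PatternOcc p → PatternOcc (reduct p)
  reduct-occ = reduct-preserves (AllP.drop⁺ 1)

  ShapeOcc : Shape → Set
  ShapeOcc (varShape _ w) = WordOcc w
  ShapeOcc (gndShape a) = HTermOcc a

  shape-occ : ∀ t → UnaryTerm t → (∀ f j → FunOccT f j t → Occ f j) → ShapeOcc (shape t)
  shape-occ (var x) _ _ = []
  shape-occ (app f zero []) _ occ = occ f 0 (inj₁ (refl , refl)) , []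
  shape-occ (app f (suc zero) (t ∷ [])) u occ with shape t | shape-occ t u (λ g j o → occ g j (inj₂ (inj₁ o)))
  ... | varShape _ _ | ws = AllP.++⁺ ws (occ f 1 (inj₁ (refl , refl)) ∷ [])
  ... | gndShape (_ , _) | h , ws = h , AllP.++⁺ ws (occ f 1 (inj₁ (refl , refl)) ∷ [])

  rawPattern-occ : ∀ {k} (ts : Vec Term k) → UnaryTerms ts → FunOccs Occ ts → PatternOcc (rawPattern ts)
  rawPattern-occ [] _ _ = []
  rawPattern-occ (t ∷ ts) (u ∷ us) occ with shape t | shape-occ t u (λ f j o → occ f j (inj₁ o))
  ... | varShape _ _ | s = s ∷ rawPattern-occ ts us (λ f j o → occ f j (inj₂ o))
  ... | gndShape _ | s = s ∷ rawPattern-occ ts us (λ f j o → occ f j (inj₂ o))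

  clashes-occ : ∀ p p′ q q′ → PatternOcc p′ → PatternOcc q → PatternOcc q′ → All HTermOcc (clashes p p′ q q′)
  clashes-occ p p′ (var· w ∷ q) (gnd g ∷ q′) occ′ (_ ∷ occ) (g-occ ∷ occ″) =
    dropSuffix-occ (length w) {g} g-occ ∷ clashes-occ p p′ q q′ occ′ occ occ″
  clashes-occ p p′ (gnd g ∷ q) (var· w′ ∷ q′) occ′ (g-occ ∷ occ) (_ ∷ occ″) =
    AllP.++⁺ matched (clashes-occ p p′ q q′ occ′ occ occ″)
    where
    matched : All HTermOcc (fromMaybe (match p (instantiate (dropSuffix (length w′) g) p′)))
    matched with match p (instantiate (dropSuffix (length w′) g) p′) in m
    ... | just _ = match-occ p (instantiate-occ (dropSuffix-occ (length w′) {g} g-occ) occ′) m ∷ []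
    ... | nothing = []
  clashes-occ p p′ (var· _ ∷ q) (var· _ ∷ q′) occ′ (_ ∷ occ) (_ ∷ occ″) = clashes-occ p p′ q q′ occ′ occ occ″
  clashes-occ p p′ (gnd _ ∷ q) (gnd _ ∷ q′) occ′ (_ ∷ occ) (_ ∷ occ″) = clashes-occ p p′ q q′ occ′ occ occ″
  clashes-occ p p′ [] _ _ _ _ = []
  clashes-occ p p′ (var· _ ∷ _) [] _ _ _ = []
  clashes-occ p p′ (gnd _ ∷ _) [] _ _ _ = []

  specials-occ : ∀ G → All (PatternOcc ∘ pattern-of) G → All HTermOcc (specials G)
  specials-occ G G-occ = AllP.filter⁺ isCon? (concatMap-all λ e∈G → concatMap-all λ e′∈G →
    let e′-occ = All.lookup G-occ e′∈G in
    clashes-occ _ _ _ _ e′-occ (All.lookup G-occ e∈G) e′-occ)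
    where
    concatMap-all : ∀ {A : Set} {f : A → List HTerm} {xs} → (∀ {x} → x ∈ xs → All HTermOcc (f x)) →
      All HTermOcc (concatMap f xs)
    concatMap-all h = AllP.concat⁺ (AllP.map⁺ (All.tabulate h))

  templates-occ : ∀ φ → AllAtoms (λ _ _ ts → UnaryTerms ts × FunOccs Occ ts) φ → All (PatternOcc ∘ pattern-of) (templates φ)
  templates-occ (lit _ _ _ ts) (us , occ) = reduct-occ _ (rawPattern-occ ts us occ) ∷ []
  templates-occ (φ ∧' ψ) (a , b) = AllP.++⁺ (templates-occ φ a) (templates-occ ψ b)
  templates-occ (φ ∨' ψ) (a , b) = AllP.++⁺ (templates-occ φ a) (templates-occ ψ b)
  templates-occ (all' _ φ) a = templates-occ φ a
  templates-occ (ex' _ φ) a = templates-occ φ a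

translate-funOcc : ∀ φ → InFragment φ → ∀ f k → FunOcc f k (translate φ) → FunOcc f k φ
translate-funOcc φ (ar , _ , _) =
  atoms-funOcc (translate φ) (translate-atoms φ axiom-occ (AllAtoms⇒AllLits lit-occ φ facts))
  where
  open Symbols (λ f k → FunOcc f k φ)
  G = templates φ
  S = specials G
  facts : AllAtoms (λ _ _ ts → UnaryTerms ts × FunOccs _ ts) φ
  facts = AllAtoms-zip φ (unaryAtoms φ ar) (funOcc-atoms φ)
  S-occ = specials-occ G (templates-occ φ facts)
  axiom-occ : ∀ {g} → g ∈ S → ∀ n → FunOccs _ (⌜ g ⌝ ∷ [])
  axiom-occ {g} g∈S _ = ⌜⌝-occ g (All.lookup S-occ g∈S)
  lit-occ : ∀ {s P k ts} → UnaryTerms ts × FunOccs _ ts →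
    AllAtoms (λ _ _ → FunOccs _) (Translation.translateLit G S s P k ts)
  lit-occ {s} {P} {k} {ts} (us , occ) = translateLit-atoms G S s P k ts
    (λ {b} {_} {a} b-source fm → ⌜⌝-occ a (firstMatch-occ G P k (instantiate-occ (source-occ b-source) p-occ) fm))
    (λ { _ _ (inj₁ ()) ; _ _ (inj₂ ()) })
    (λ {x} _ _ → applyWord-var-occ x (prefixOf ts) (prefix-occ _ raw-occ))
    where
    raw-occ = rawPattern-occ ts us occ
    p-occ = reduct-occ _ raw-occ
    source-occ : ∀ {b} → b ≡ (⋆ , []) ⊎ b ∈ S → HTermOcc b
    source-occ (inj₁ refl) = tt , []
    source-occ (inj₂ b∈S) = All.lookup S-occ b∈S

size : HTerm → ℕ
size (_ , w) = length w

Bounded : ℕ → Pattern → Set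
Bounded B = All (ArgAll (λ w → length w ≤ B) (λ g → size g ≤ B))

ShapeBounded : ℕ → Shape → Set
ShapeBounded B (varShape _ w) = length w ≤ B
ShapeBounded B (gndShape a) = size a ≤ B

length-snoc : ∀ (w : Word) f → length (w ++ [ f ]) ≡ suc (length w)
length-snoc w f = trans (length-++ w) (+-comm (length w) 1)

shape-bounded : ∀ t → UnaryTerm t → ShapeBounded (lenT t) (shape t)
shape-bounded (var x) _ = z≤n
shape-bounded (app f zero []) _ = z≤n
shape-bounded (app f (suc zero) (t ∷ [])) u with shape t | shape-bounded t u
... | varShape _ w | b = ≤-trans (≤-reflexive (length-snoc w f)) (s≤s (≤-trans b (m≤m+n (lenT t) 0)))
... | gndShape (_ , w) | b = ≤-trans (≤-reflexive (length-snoc w f)) (s≤s (≤-trans b (m≤m+n (lenT t) 0)))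

rawPattern-bounded : ∀ {k B} (ts : Vec Term k) → UnaryTerms ts → lenTs ts ≤ B → Bounded B (rawPattern ts)
rawPattern-bounded [] _ _ = []
rawPattern-bounded (t ∷ ts) (u ∷ us) le with shape t | shape-bounded t u
... | varShape _ _ | b = ≤-trans b (≤-trans (m≤m+n _ _) le) ∷ rawPattern-bounded ts us (≤-trans (m≤n+m _ _) le)
... | gndShape _ | b = ≤-trans b (≤-trans (m≤m+n _ _) le) ∷ rawPattern-bounded ts us (≤-trans (m≤n+m _ _) le)

reduct-bounded : ∀ {B} p → Bounded B p → Bounded B (reduct p)
reduct-bounded = reduct-preserves (λ {w} b → ≤-trans (≤-reflexive (List.length-drop 1 w)) (≤-trans (m∸n≤m _ 1) b))

length-rawPattern : ∀ {k} (ts : Vec Term k) → length (rawPattern ts) ≡ k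
length-rawPattern [] = refl
length-rawPattern (t ∷ ts) = cong suc (length-rawPattern ts)

arity≤lenTs : ∀ {k} (ts : Vec Term k) → k ≤ lenTs ts
arity≤lenTs [] = z≤n
arity≤lenTs (var _ ∷ ts) = s≤s (arity≤lenTs ts)
arity≤lenTs (app _ _ _ ∷ ts) = s≤s (≤-trans (arity≤lenTs ts) (m≤n+m _ _))

length-patternOf : ∀ {k} (ts : Vec Term k) → length (patternOf ts) ≤ lenTs ts
length-patternOf ts = ≤-trans (≤-reflexive (trans (length-reduct (rawPattern ts)) (length-rawPattern ts))) (arity≤lenTs ts)

firstWord-bounded : ∀ {B p} → Bounded B p → length (firstWord p) ≤ B
firstWord-bounded [] = z≤n
firstWord-bounded {p = var· _ ∷ _} (b ∷ _) = b
firstWord-bounded {p = gnd _ ∷ _} (_ ∷ bs) = firstWord-bounded bs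

prefix-bounded : ∀ {B} p → Bounded B p → length (prefix p) ≤ B
prefix-bounded p bs = let v , e = prefix-firstWord p in
  ≤-trans (m≤m+n _ (length v))
    (≤-trans (≤-reflexive (sym (trans (cong length e) (length-++ (prefix p))))) (firstWord-bounded bs))

size-dropSuffix : ∀ n a → size (dropSuffix n a) ≤ size a
size-dropSuffix n (_ , w) = ≤-trans (≤-reflexive (List.length-take (length w ∸ n) w)) (m⊓n≤n _ _)

size-candidate : ∀ {M} p {τ} → All (λ t → size t ≤ M) τ → size (candidate p τ) ≤ M
size-candidate (var· w ∷ _) {t ∷ _} (b ∷ _) = ≤-trans (size-dropSuffix (length w) t) b
size-candidate (gnd _ ∷ p) (_ ∷ bs) = size-candidate p bs
size-candidate [] _ = z≤n
size-candidate (var· _ ∷ _) [] = z≤n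
size-candidate (gnd _ ∷ _) [] = z≤n

size-match : ∀ {M} p {τ a} → All (λ t → size t ≤ M) τ → match p τ ≡ just a → size a ≤ M
size-match p bs m with refl , _ ← match-sound p _ m = size-candidate p bs

size-instantiate : ∀ {A B} a p → size a ≤ A → Bounded B p → All (λ t → size t ≤ A + B) (instantiate a p)
size-instantiate a [] _ [] = []
size-instantiate (_ , u) (var· w ∷ p) a≤ (b ∷ bs) =
  ≤-trans (≤-reflexive (length-++ u)) (+-mono-≤ a≤ b) ∷ size-instantiate (_ , u) p a≤ bs
size-instantiate {A} a (gnd _ ∷ p) a≤ (b ∷ bs) = ≤-trans b (m≤n+m _ A) ∷ size-instantiate a p a≤ bs

size-clashes : ∀ {B} p p′ q q′ → Bounded B p′ → Bounded B q → Bounded B q′ → All (λ t → size t ≤ B + B) (clashes p p′ q q′)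
size-clashes {B} p p′ (var· w ∷ q) (gnd g ∷ q′) b′ (_ ∷ bq) (bg ∷ bq′) =
  ≤-trans (size-dropSuffix (length w) g) (≤-trans bg (m≤m+n B B)) ∷ size-clashes p p′ q q′ b′ bq bq′
size-clashes {B} p p′ (gnd g ∷ q) (var· w′ ∷ q′) b′ (bg ∷ bq) (_ ∷ bq′) =
  AllP.++⁺ matched (size-clashes p p′ q q′ b′ bq bq′)
  where
  matched : All (λ t → size t ≤ B + B) (fromMaybe (match p (instantiate (dropSuffix (length w′) g) p′)))
  matched with match p (instantiate (dropSuffix (length w′) g) p′) in m
  ... | just _ = size-match p (size-instantiate _ p′ (≤-trans (size-dropSuffix (length w′) g) bg) b′) m ∷ []
  ... | nothing = []
size-clashes p p′ (var· _ ∷ q) (var· _ ∷ q′) b′ (_ ∷ bq) (_ ∷ bq′) = size-clashes p p′ q q′ b′ bq bq′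
size-clashes p p′ (gnd _ ∷ q) (gnd _ ∷ q′) b′ (_ ∷ bq) (_ ∷ bq′) = size-clashes p p′ q q′ b′ bq bq′
size-clashes p p′ [] _ _ _ _ = []
size-clashes p p′ (var· _ ∷ _) [] _ _ _ = []
size-clashes p p′ (gnd _ ∷ _) [] _ _ _ = []

length-clashes : ∀ p p′ q q′ → length (clashes p p′ q q′) ≤ length q′
length-clashes p p′ (var· _ ∷ q) (gnd _ ∷ q′) = s≤s (length-clashes p p′ q q′)
length-clashes p p′ (gnd g ∷ q) (var· w′ ∷ q′) =
  ≤-trans (≤-reflexive (length-++ (fromMaybe m))) (+-mono-≤ (length-fromMaybe m) (length-clashes p p′ q q′))
  where
  m = match p (instantiate (dropSuffix (length w′) g) p′)
  length-fromMaybe : ∀ (m : Maybe HTerm) → length (fromMaybe m) ≤ 1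
  length-fromMaybe (just _) = s≤s z≤n
  length-fromMaybe nothing = z≤n
length-clashes p p′ (var· _ ∷ q) (var· _ ∷ q′) = m≤n⇒m≤1+n (length-clashes p p′ q q′)
length-clashes p p′ (gnd _ ∷ q) (gnd _ ∷ q′) = m≤n⇒m≤1+n (length-clashes p p′ q q′)
length-clashes p p′ [] _ = z≤n
length-clashes p p′ (var· _ ∷ _) [] = z≤n
length-clashes p p′ (gnd _ ∷ _) [] = z≤n

size-specials : ∀ {B} G → All (Bounded B ∘ pattern-of) G → All (λ t → size t ≤ B + B) (specials G)
size-specials G bs = AllP.filter⁺ isCon? (AllP.concat⁺ (AllP.map⁺ (All.tabulate λ e∈G →
  AllP.concat⁺ (AllP.map⁺ (All.tabulate λ e′∈G →
    let b′ = All.lookup bs e′∈G in size-clashes _ _ _ _ b′ (All.lookup bs e∈G) b′)))))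

sum-map-mono : ∀ {A : Set} (f g : A → ℕ) xs → (∀ x → f x ≤ g x) → sum (map f xs) ≤ sum (map g xs)
sum-map-mono f g [] _ = z≤n
sum-map-mono f g (x ∷ xs) f≤g = +-mono-≤ (f≤g x) (sum-map-mono f g xs f≤g)

length-concatMap : ∀ {A B : Set} (f : A → List B) xs → length (concatMap f xs) ≡ sum (map (length ∘ f) xs)
length-concatMap f [] = refl
length-concatMap f (x ∷ xs) = trans (length-++ (f x)) (cong (length (f x) +_) (length-concatMap f xs))

sum-map-const : ∀ {A : Set} c (xs : List A) → sum (map (λ _ → c) xs) ≡ length xs * c
sum-map-const c [] = refl
sum-map-const c (x ∷ xs) = cong (c +_) (sum-map-const c xs)

mass : List Template → ℕ
mass G = sum (map (length ∘ pattern-of) G)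

length-specials : ∀ G → length (specials G) ≤ length G * mass G
length-specials G = begin
  length (specials G)                                  ≤⟨ List.length-filter isCon? (concatMap (clashesWith G) G) ⟩
  length (concatMap (clashesWith G) G)                 ≡⟨ length-concatMap (clashesWith G) G ⟩
  sum (map (length ∘ clashesWith G) G)                 ≤⟨ sum-map-mono _ _ G length-clashesWith ⟩
  sum (map (λ _ → mass G) G)                           ≡⟨ sum-map-const (mass G) G ⟩
  length G * mass G                                    ∎
  where
  open ≤-Reasoning
  length-clashesWith : ∀ e → length (clashesWith G e) ≤ mass G
  length-clashesWith e = ≤-trans (≤-reflexive (length-concatMap _ G))
    (sum-map-mono _ _ G λ e′ → length-clashes (pattern-of e) (pattern-of e′) (pattern-of e) (pattern-of e′))

lenTs-atoms : ∀ φ {m} → len φ ≤ m → AllAtoms (λ _ _ ts → lenTs ts ≤ m) φ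
lenTs-atoms (lit true _ _ _) le = ≤-trans (n≤1+n _) le
lenTs-atoms (lit false _ _ _) le = ≤-trans (≤-trans (n≤1+n _) (n≤1+n _)) le
lenTs-atoms (φ ∧' ψ) le =
  lenTs-atoms φ (≤-trans (≤-trans (m≤m+n _ _) (n≤1+n _)) le) , lenTs-atoms ψ (≤-trans (≤-trans (m≤n+m _ _) (n≤1+n _)) le)
lenTs-atoms (φ ∨' ψ) le =
  lenTs-atoms φ (≤-trans (≤-trans (m≤m+n _ _) (n≤1+n _)) le) , lenTs-atoms ψ (≤-trans (≤-trans (m≤n+m _ _) (n≤1+n _)) le)
lenTs-atoms (all' _ φ) le = lenTs-atoms φ (≤-trans (≤-trans (n≤1+n _) (n≤1+n _)) le)
lenTs-atoms (ex' _ φ) le = lenTs-atoms φ (≤-trans (≤-trans (n≤1+n _) (n≤1+n _)) le)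

templates-bounded : ∀ {B} φ → AllAtoms (λ _ _ ts → UnaryTerms ts × lenTs ts ≤ B) φ → All (Bounded B ∘ pattern-of) (templates φ)
templates-bounded (lit _ _ _ ts) (us , le) = reduct-bounded _ (rawPattern-bounded ts us le) ∷ []
templates-bounded (φ ∧' ψ) (a , b) = AllP.++⁺ (templates-bounded φ a) (templates-bounded ψ b)
templates-bounded (φ ∨' ψ) (a , b) = AllP.++⁺ (templates-bounded φ a) (templates-bounded ψ b)
templates-bounded (all' _ φ) a = templates-bounded φ a
templates-bounded (ex' _ φ) a = templates-bounded φ a

length-templates : ∀ φ → length (templates φ) ≤ len φ
length-templates (lit true _ _ _) = s≤s z≤n
length-templates (lit false _ _ _) = s≤s z≤n
length-templates (φ ∧' ψ) =
  ≤-trans (≤-reflexive (length-++ (templates φ))) (m≤n⇒m≤1+n (+-mono-≤ (length-templates φ) (length-templates ψ)))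
length-templates (φ ∨' ψ) =
  ≤-trans (≤-reflexive (length-++ (templates φ))) (m≤n⇒m≤1+n (+-mono-≤ (length-templates φ) (length-templates ψ)))
length-templates (all' _ φ) = m≤n⇒m≤1+n (m≤n⇒m≤1+n (length-templates φ))
length-templates (ex' _ φ) = m≤n⇒m≤1+n (m≤n⇒m≤1+n (length-templates φ))

mass-++ : ∀ G G′ → mass (G ++ G′) ≡ mass G + mass G′
mass-++ G G′ = trans (cong sum (List.map-++ (length ∘ pattern-of) G G′)) (sum-++ (map _ G) _)

mass-templates : ∀ φ → mass (templates φ) ≤ len φ
mass-templates (lit true _ _ ts) = ≤-trans (≤-reflexive (+-identityʳ _)) (≤-trans (length-patternOf ts) (n≤1+n _))
mass-templates (lit false _ _ ts) =
  ≤-trans (≤-reflexive (+-identityʳ _)) (≤-trans (length-patternOf ts) (≤-trans (n≤1+n _) (n≤1+n _)))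
mass-templates (φ ∧' ψ) =
  ≤-trans (≤-reflexive (mass-++ (templates φ) _)) (m≤n⇒m≤1+n (+-mono-≤ (mass-templates φ) (mass-templates ψ)))
mass-templates (φ ∨' ψ) =
  ≤-trans (≤-reflexive (mass-++ (templates φ) _)) (m≤n⇒m≤1+n (+-mono-≤ (mass-templates φ) (mass-templates ψ)))
mass-templates (all' _ φ) = m≤n⇒m≤1+n (m≤n⇒m≤1+n (mass-templates φ))
mass-templates (ex' _ φ) = m≤n⇒m≤1+n (m≤n⇒m≤1+n (mass-templates φ))

lenT-applyWord : ∀ t w → lenT (applyWord t w) ≡ lenT t + length w
lenT-applyWord t [] = sym (+-identityʳ (lenT t))
lenT-applyWord t (f ∷ w) = trans (lenT-applyWord (app f 1 (t ∷ [])) w)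
  (trans (cong (λ m → suc m + length w) (+-identityʳ (lenT t))) (sym (+-suc (lenT t) (length w))))

lenT-⌜⌝ : ∀ a → lenT ⌜ a ⌝ ≡ suc (size a)
lenT-⌜⌝ (⋆ , w) = lenT-applyWord (var 0) w
lenT-⌜⌝ (con c , w) = lenT-applyWord (app c 0 []) w

len-unaryLit : ∀ s P t → len (lit s P 1 (t ∷ [])) ≤ 2 + lenT t
len-unaryLit true P t = s≤s (≤-trans (≤-reflexive (+-identityʳ (lenT t))) (n≤1+n _))
len-unaryLit false P t = s≤s (s≤s (≤-reflexive (+-identityʳ (lenT t))))

len-canonicalLit : ∀ {M} G s P k τ → All (λ t → size t ≤ M) τ → len (canonicalLit G s P k τ) ≤ 5 + M
len-canonicalLit G s P k τ bs with firstMatch G P k τ in fm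
... | just (i , a) with p , _ , m ← firstMatch-sound G P k τ fm =
  s≤s (s≤s (≤-trans (len-unaryLit s _ ⌜ a ⌝) (s≤s (s≤s (≤-trans (≤-reflexive (lenT-⌜⌝ a)) (s≤s (size-match p bs m)))))))
... | nothing = s≤s (s≤s (≤-trans (len-unaryLit s 0 (var 0)) (s≤s (s≤s (s≤s z≤n)))))

len-bigAnd : ∀ c base gs {B} → (∀ {g} → g ∈ gs → suc (len (c g)) ≤ B) → len (bigAnd c base gs) ≤ length gs * B + len base
len-bigAnd c base [] _ = ≤-refl
len-bigAnd c base (g ∷ gs) {B} bs =
  ≤-trans (+-mono-≤ (bs (here refl)) (len-bigAnd c base gs (bs ∘ there))) (≤-reflexive (sym (+-assoc B _ _)))

len-pos : ∀ φ → 1 ≤ len φ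
len-pos (lit true _ _ _) = s≤s z≤n
len-pos (lit false _ _ _) = s≤s z≤n
len-pos (_ ∧' _) = s≤s z≤n
len-pos (_ ∨' _) = s≤s z≤n
len-pos (all' _ _) = s≤s z≤n
len-pos (ex' _ _) = s≤s z≤n

len-mapLits : ∀ tr φ {K} → 1 ≤ K → AllLits (λ s P k ts → len (tr s P k ts) ≤ K) φ → len (mapLits tr φ) ≤ K * len φ
len-mapLits tr (lit s P k ts) {K} 1≤K le =
  ≤-trans le (≤-trans (≤-reflexive (sym (*-identityʳ K))) (*-mono-≤ (≤-refl {K}) (len-pos (lit s P k ts))))
len-mapLits tr (φ ∧' ψ) {K} 1≤K (le , le′) =
  ≤-trans (+-mono-≤ 1≤K (+-mono-≤ (len-mapLits tr φ 1≤K le) (len-mapLits tr ψ 1≤K le′)))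
    (≤-reflexive (trans (cong (K +_) (sym (*-distribˡ-+ K (len φ) (len ψ)))) (sym (*-suc K _))))
len-mapLits tr (φ ∨' ψ) {K} 1≤K (le , le′) =
  ≤-trans (+-mono-≤ 1≤K (+-mono-≤ (len-mapLits tr φ 1≤K le) (len-mapLits tr ψ 1≤K le′)))
    (≤-reflexive (trans (cong (K +_) (sym (*-distribˡ-+ K (len φ) (len ψ)))) (sym (*-suc K _))))
len-mapLits tr (all' _ φ) {K} 1≤K le =
  ≤-trans (+-mono-≤ 1≤K (+-mono-≤ 1≤K (len-mapLits tr φ 1≤K le)))
    (≤-reflexive (trans (cong (K +_) (sym (*-suc K _))) (sym (*-suc K _))))
len-mapLits tr (ex' _ φ) {K} 1≤K le =
  ≤-trans (+-mono-≤ 1≤K (+-mono-≤ 1≤K (len-mapLits tr φ 1≤K le)))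
    (≤-reflexive (trans (cong (K +_) (sym (*-suc K _))) (sym (*-suc K _))))

module _ {n : ℕ} (1≤n : 1 ≤ n) where

  ≤*n : ∀ a → a ≤ a * n
  ≤*n a = ≤-trans (≤-reflexive (sym (*-identityʳ a))) (*-mono-≤ (≤-refl {a}) 1≤n)

  affine≤ : ∀ a b → a + b * n ≤ (a + b) * n
  affine≤ a b = ≤-trans (+-mono-≤ (≤*n a) (≤-refl {b * n})) (≤-reflexive (sym (*-distribʳ-+ n a b)))

  n≤n³ : n ≤ n * (n * n)
  n≤n³ = ≤-trans (≤*n n) (*-mono-≤ (≤-refl {n}) (≤*n n))

  guard-arith : 2 + ((3 + n) + (5 + ((n + n) + n))) ≤ 14 * n
  guard-arith = ≤-trans (≤-reflexive (e n)) (affine≤ 10 4)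
    where
    e : ∀ n → 2 + ((3 + n) + (5 + ((n + n) + n))) ≡ 10 + 4 * n
    e = solve-∀

  base-arith : 3 + n ≤ 4 * n
  base-arith = ≤-trans (≤-reflexive (cong (3 +_) (sym (*-identityˡ n)))) (affine≤ 3 1)

  ground-arith : 5 + (0 + n) ≤ 18 * (n * (n * n))
  ground-arith = ≤-trans (≤-reflexive (cong (5 +_) (sym (*-identityˡ n)))) (≤-trans (affine≤ 5 1)
    (≤-trans (*-mono-≤ (≤-refl {6}) n≤n³) (*-mono-≤ {6} {18} {n * (n * n)} (m≤m+n 6 12) ≤-refl)))

  var-arith : (n * n) * (14 * n) + 4 * n ≤ 18 * (n * (n * n))
  var-arith = ≤-trans (+-mono-≤ (≤-refl {(n * n) * (14 * n)}) (*-mono-≤ (≤-refl {4}) n≤n³)) (≤-reflexive (e n))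
    where
    e : ∀ n → (n * n) * (14 * n) + 4 * (n * (n * n)) ≡ 18 * (n * (n * n))
    e = solve-∀

  axiom-arith : 3 + (n + n) ≤ 5 * n
  axiom-arith = ≤-trans (≤-reflexive (e n)) (affine≤ 3 2)
    where
    e : ∀ n → 3 + (n + n) ≡ 3 + 2 * n
    e = solve-∀

  total-arith : (n * n) * (5 * n) + (18 * (n * (n * n))) * n ≤ 23 * n ^ 4
  total-arith = ≤-trans (+-mono-≤ (≤-trans (≤-reflexive (e₁ n)) (*-mono-≤ (≤-refl {5}) (≤*n (n * (n * n))))) ≤-refl)
    (≤-reflexive (e₂ n))
    where
    e₁ : ∀ n → (n * n) * (5 * n) ≡ 5 * (n * (n * n))
    e₁ = solve-∀
    e₂ : ∀ n → 5 * ((n * (n * n)) * n) + (18 * (n * (n * n))) * n ≡ 23 * (n * (n * (n * (n * 1))))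
    e₂ = solve-∀

translate-length : ∀ φ → FunArityAtMostOne φ → len (translate φ) ≤ 23 * len φ ^ 4
translate-length φ ar = begin
  len (translate φ)                                   ≤⟨ len-bigAnd axiom _ S axiom-bound ⟩
  length S * (5 * n) + len (mapLits translateLit φ)   ≤⟨ +-mono-≤ (*-mono-≤ |S|≤n² (≤-refl {5 * n})) lits-bound ⟩
  (n * n) * (5 * n) + K * n                           ≤⟨ total-arith 1≤n ⟩
  23 * n ^ 4                                          ∎
  where
  open ≤-Reasoning
  n = len φ
  1≤n = len-pos φ
  G = templates φ
  S = specials G
  open Translation G S
  K = 18 * (n * (n * n))

  facts : AllAtoms (λ _ _ ts → UnaryTerms ts × lenTs ts ≤ n) φ
  facts = AllAtoms-zip φ (unaryAtoms φ ar) (lenTs-atoms φ ≤-refl)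

  |S|≤n² : length S ≤ n * n
  |S|≤n² = ≤-trans (length-specials G) (*-mono-≤ (length-templates φ) (mass-templates φ))

  S-size : All (λ g → size g ≤ n + n) S
  S-size = size-specials G (templates-bounded φ facts)

  axiom-bound : ∀ {g} → g ∈ S → suc (len (axiom g)) ≤ 5 * n
  axiom-bound {g} g∈S = ≤-trans (s≤s (s≤s (≤-reflexive (trans (+-identityʳ _) (lenT-⌜⌝ g)))))
                          (≤-trans (s≤s (s≤s (s≤s (All.lookup S-size g∈S)))) (axiom-arith 1≤n))

  literal-bound : ∀ {s P k ts} → UnaryTerms ts × lenTs ts ≤ n → len (translateLit s P k ts) ≤ K
  literal-bound {s} {P} {k} {ts} (us , le) with varsTs ts
  ... | [] = ≤-trans (len-canonicalLit G s P k _ (size-instantiate (⋆ , []) p z≤n p-bounded)) (ground-arith 1≤n)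
    where
    p = patternOf ts
    p-bounded = reduct-bounded _ (rawPattern-bounded ts us le)
  ... | x ∷ _ = begin
      len (bigAnd (guarded s P k p xu) mainLit S) ≤⟨ len-bigAnd _ _ S guard-bound ⟩
      length S * (14 * n) + len mainLit
        ≤⟨ +-mono-≤ (*-mono-≤ |S|≤n² (≤-refl {14 * n})) (≤-trans (xu-lit s _) (base-arith 1≤n)) ⟩
      (n * n) * (14 * n) + 4 * n            ≤⟨ var-arith 1≤n ⟩
      K                                     ∎
    where
    raw-bounded = rawPattern-bounded ts us le
    p = patternOf ts
    xu = applyWord (var x) (prefixOf ts)
    mainLit = lit s (patternPred (indexOf template≟ G (templateOf P k ts))) 1 (xu ∷ [])
    xu-lit : ∀ s′ m → len (lit s′ m 1 (xu ∷ [])) ≤ 3 + n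
    xu-lit s′ m = ≤-trans (len-unaryLit s′ m xu)
      (s≤s (s≤s (≤-trans (≤-reflexive (lenT-applyWord (var x) (prefixOf ts))) (s≤s (prefix-bounded _ raw-bounded)))))
    guard-bound : ∀ {g} → g ∈ S → suc (len (guarded s P k p xu g)) ≤ 14 * n
    guard-bound {g} g∈S = ≤-trans (s≤s (s≤s (+-mono-≤ (xu-lit false (specialPred (indexOf hterm≟ S g)))
      (len-canonicalLit G s P k _ (size-instantiate _ p (All.lookup S-size g∈S) (reduct-bounded _ raw-bounded))))))
      (guard-arith 1≤n)

  lits-bound : len (mapLits translateLit φ) ≤ K * n
  lits-bound = len-mapLits translateLit φ (≤-trans 1≤n (≤-trans (n≤n³ 1≤n) (m≤n*m _ 18)))
    (AllAtoms⇒AllLits (λ {s P k ts} → literal-bound {s} {P} {k} {ts}) φ facts)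

lemma14 : Σ (Formula → Formula) λ T →
    Σ ℕ λ c → Σ ℕ λ N →
      ∀ φ → Sentence φ → InFragment φ →
        Sentence (T φ)
        × Equisatisfiable φ (T φ)
        × AllPredsUnary (T φ)
        × (∀ f k → FunOcc f k (T φ) → FunOcc f k φ)
        × (N ≤ len φ → len (T φ) ≤ c * len φ ^ 4)
lemma14 = translate , 23 , 0 , λ φ closed frag →
  translate-sentence φ closed ,
  translate-equisatisfiable φ frag ,
  translate-unaryPreds φ ,
  translate-funOcc φ frag ,
  (λ _ → translate-length φ (proj₁ frag))
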